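{- Let $w\in S_m$ be a permutation. Any maximal weakly separated collection of the $w$-chamber set $\mathcal{H}(w)$ has cardinality $m+\ell(w)+1$, where $\ell(w)$ is the length (number of inversions) of $w$.
   Context: For sets of integers $A,B$ write $A\prec B$ if $a<b$ for all $a\in A$, $b\in B$. Subsets $I,J\subseteq[m]=\{1,\dots,m\}$ are weakly separated in the sense of Leclerc and Zelevinsky if at least one of the following holds: (1) $|I|\ge|J|$ and $J\setminus I$ can be partitioned as $J'\sqcup J''$ with $J'\prec I\setminus J\prec J''$; (2) $|J|\ge|I|$ and $I\setminus J$ can be partitioned as $I'\sqcup I''$ with $I'\prec J\setminus I\prec I''$. (Parts may be empty.) The $w$-chamber set $\mathcal{H}(w)$ is the collection of subsets $I\subseteq[m]$ such that for every pair $a<b$ with $w(a)<w(b)$, if $a\in I$ then $b\in I$. A weakly separated collection of $\mathcal{H}(w)$ is a set of elements of $\mathcal{H}(w)$ that are pairwise weakly separated in the sense of Leclerc and Zelevinsky; it is maximal if it is maximal under inclusion among such collections. -}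

module Defs where

open import Data.Nat using (ℕ; _≥_)
open import Data.Fin using (Fin; _<_)
open import Data.Fin.Properties using (_<?_)
open import Data.Fin.Permutation using (Permutation′; _⟨$⟩ʳ_)
open import Data.Fin.Subset using (Subset; _∈_; _─_; _∪_; _∩_; ⊥; ∣_∣)
open import Data.List using (List; length; filter; allFin; cartesianProduct)
import Data.List.Membership.Propositional as List
open import Data.List.Relation.Binary.Subset.Propositional using (_⊆_)
open import Data.List.Relation.Unary.Unique.Propositional using (Unique)
open import Data.Product using (_×_; _,_; ∃₂)
open import Data.Sum using (_⊎_)
open import Relation.Binary.PropositionalEquality using (_≡_)
open import Relation.Nullary using (Dec)
open import Relation.Nullary.Decidable using (_×-dec_)

-- The ground set [m] = {1, …, m} is represented by Fin m = {0, …, m-1}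
-- with its usual order.

infix 4 _≺_

_≺_ : ∀ {m} → Subset m → Subset m → Set
A ≺ B = ∀ {a b} → a ∈ A → b ∈ B → a < b

IsPartition : ∀ {m} → Subset m → Subset m → Subset m → Set
IsPartition P P′ P″ = (P′ ∪ P″ ≡ P) × (P′ ∩ P″ ≡ ⊥)

-- Condition (1) of weak separation; condition (2) is the same condition
-- with I and J exchanged.
Surrounds : ∀ {m} → Subset m → Subset m → Set
Surrounds I J =
  ∣ I ∣ ≥ ∣ J ∣ ×
  ∃₂ λ J′ J″ → IsPartition (J ─ I) J′ J″ × J′ ≺ (I ─ J) × (I ─ J) ≺ J″

WeaklySeparated : ∀ {m} → Subset m → Subset m → Set
WeaklySeparated I J = Surrounds I J ⊎ Surrounds J I

ChamberSet : ∀ {m} → Permutation′ m → Subset m → Set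
ChamberSet w I = ∀ {a b} → a < b → (w ⟨$⟩ʳ a) < (w ⟨$⟩ʳ b) → a ∈ I → b ∈ I

Inversion : ∀ {m} → Permutation′ m → Fin m × Fin m → Set
Inversion w (a , b) = a < b × (w ⟨$⟩ʳ b) < (w ⟨$⟩ʳ a)

inversion? : ∀ {m} (w : Permutation′ m) (p : Fin m × Fin m) → Dec (Inversion w p)
inversion? w (a , b) = (a <? b) ×-dec ((w ⟨$⟩ʳ b) <? (w ⟨$⟩ʳ a))

ℓ : ∀ {m} → Permutation′ m → ℕ
ℓ {m} w = length (filter (inversion? w) (cartesianProduct (allFin m) (allFin m)))

-- A set of subsets of [m] is represented by a duplicate-free list, so that
-- its cardinality is the length of the list.
record WeaklySeparatedCollection {m} (w : Permutation′ m) (C : List (Subset m)) : Set where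
  field
    unique    : Unique C
    chamber   : ∀ {I} → I List.∈ C → ChamberSet w I
    separated : ∀ {I J} → I List.∈ C → J List.∈ C → WeaklySeparated I J

record MaximalWeaklySeparatedCollection {m} (w : Permutation′ m) (C : List (Subset m)) : Set where
  field
    collection : WeaklySeparatedCollection w C
    maximal    : ∀ {D} → WeaklySeparatedCollection w D → C ⊆ D → D ⊆ C

{-# OPTIONS --safe #-}
module Submission where

-- Weak separation of I and J says that, for the smaller set J, no element of J ∖ I lies between two
-- elements of I ∖ J.
--
-- Consider first all subsets of a ground set G with least element ε and greatest element μ.
-- Deleting ε, or μ, from all members of a separated collection keeps it separated.  If C is maximal,
-- deleting μ identifies T with T ∪ μ when both are in C.  Such doubled T exist for every size below |G|:
-- delete ε, complete the result to a maximal collection on G ∖ ε, and take its doubled sets V and U of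
-- sizes i - 1 and i; a member of C preventing U from being doubled in C and a member preventing V ∪ ε
-- from being doubled in C would not be separated from each other.  There is only one doubled set of each
-- size, so deleting μ loses exactly |G| members.  The result C/μ is again maximal: let Z be separated
-- from C/μ and T doubled of size |Z|.  If Z lies to one side of T, then Z or Z ∪ μ can be added to C;
-- otherwise T surrounds Z, or Z surrounds T, and this is impossible because C contains some T ∪ c with
-- c < μ (found by the same induction deleting ε), and dually some (T ∪ μ) ∖ c.  Hence |C| is determined
-- by induction on |G|.
--
-- For general w, pick a < b with w(b) = w(a) + 1 and exchange these two values.  This creates one
-- inversion and one new member {x : w′(x) ≥ w(b)} of every maximal collection, and the permutation
-- without ascents has all subsets in its chamber set.

open import Defs
open import Data.Bool.Properties using () renaming (_≟_ to _≟ᵇ_)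
open import Data.Empty using (⊥; ⊥-elim)
open import Data.Fin using (Fin; zero; suc; toℕ; fromℕ<; _<_; _≤_)
open import Data.Fin.Permutation using (Permutation′; _⟨$⟩ʳ_; _⟨$⟩ˡ_; inverseˡ; inverseʳ; _∘ₚ_; transpose)
open import Data.Fin.Properties using (_≟_; _<?_; _≤?_; any?; all?; ¬∀⟶∃¬; toℕ<n; toℕ-fromℕ<; toℕ-injective; <-isStrictTotalOrder; <-cmp; <-asym; <-irrefl; <-trans)
import Data.Fin.Subset as Subset
open import Data.Fin.Subset using (Subset; inside; outside; _∈_; _∉_; _⊆_; _─_; _∪_; _∩_; ∣_∣; Nonempty; Empty)
open import Data.Fin.Subset.Properties using (_∈?_; _⊆?_; nonempty?; ⊆-refl; ⊆-antisym; drop-∷-⊆; ∉⊥; ∣⊥∣≡0; ∈⊤; ∣⊤∣≡n; Empty-unique; x∈p∪q⁺; x∈p∪q⁻; x∈p∩q⁻; p─q⊆p; x∈p∧x∉q⇒x∈p─q; p⊆q⇒∣p∣≤∣q∣; p⊂q⇒∣p∣<∣q∣)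
open import Data.List using (List; []; _∷_; _++_; map; length; filter; deduplicate; upTo; allFin; cartesianProduct)
open import Data.List.Properties using (length-map; length-++; length-upTo; length-tabulate; length-filter)
import Data.List.Membership.DecPropositional as DecMembership
import Data.List.Membership.Propositional as List
open import Data.List.Membership.Propositional.Properties using (∈-map⁺; ∈-map⁻; ∈-++⁺ˡ; ∈-++⁺ʳ; ∈-++⁻; ∈-filter⁺; ∈-filter⁻; ∈-deduplicate⁺; ∈-deduplicate⁻; ∈-upTo⁺; ∈-upTo⁻; ∈-cartesianProduct⁺; ∈-allFin)
open import Data.List.Membership.Propositional.Properties.WithK using (unique∧set⇒bag)
open import Data.List.Relation.Binary.BagAndSetEquality using (∼bag⇒↭)
open import Data.List.Relation.Binary.Permutation.Propositional.Properties using (↭-length)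
open import Data.List.Relation.Unary.All as All using ([]; _∷_)
open import Data.List.Relation.Unary.AllPairs using ([]; _∷_)
open import Data.List.Relation.Unary.Any using (here; there)
open import Data.List.Relation.Unary.Unique.DecPropositional.Properties using (deduplicate-!)
open import Data.List.Relation.Unary.Unique.Propositional using (Unique)
import Data.List.Relation.Unary.Unique.Propositional.Properties as Unique
open import Data.Nat as ℕ using (ℕ; zero; suc; _+_; s≤s; z≤n)
import Data.Nat.Properties as ℕ
open import Data.Product using (_×_; _,_; ∃; proj₁; proj₂)
open import Data.Sum using (_⊎_; inj₁; inj₂; [_,_]′) renaming (swap to ⊎-swap)
open import Data.Vec using ([]; _∷_; _[_]≔_; here; there; tabulate)
open import Data.Vec.Properties using ([]≔-updates; []≔-minimal; []≔-commutes; []=⇒lookup; lookup⇒[]=; lookup∘update; lookup∘update′; lookup∘tabulate; ≡-dec)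
open import Function using (flip; _∘_; mk⇔)
open import Relation.Binary using (DecidableEquality; IsStrictTotalOrder; Tri; tri<; tri≈; tri>)
open import Relation.Binary.PropositionalEquality using (_≡_; _≢_; refl; sym; trans; cong; cong₂; subst; subst₂; module ≡-Reasoning)
open import Relation.Nullary using (¬_; Dec; yes; no; does)
open import Relation.Nullary.Decidable using (_×-dec_; _⊎-dec_; _→-dec_; ¬?; decidable-stable; dec-true; dec-false)
open import Relation.Nullary.Negation using (contradiction)

-- Configurations of set differences

-- D I J x stands for x ∈ I ∖ J.  Working with D alone makes every statement available a second time
-- with D reversed, which is the statement for the complementary sets.
module Patterns
  {S E : Set} {_<_ : E → E → Set} (order : IsStrictTotalOrder _≡_ _<_)
  (D : S → S → E → Set)
  (split : ∀ {I K x} J → D I K x → D I J x ⊎ D J K x)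
  (disjoint : ∀ {I J K x} → D I J x → D J K x → ⊥)
  where

  open IsStrictTotalOrder order using (compare; asym) renaming (trans to trans-<)

  infix 4 _◁_

  _◁_ : S → S → Set
  I ◁ J = ∀ {x y} → D I J x → D J I y → x < y

  Alt NoAlt : S → S → Set
  Alt I J = ∃ λ x → ∃ λ y → ∃ λ z → D I J x × D J I y × D I J z × x < y × y < z
  NoAlt I J = ¬ Alt I J

  alt : ∀ {I J x y z} → D I J x → D J I y → D I J z → x < y → y < z → Alt I J
  alt p q r s t = _ , _ , _ , p , q , r , s , t

  -- Stands in for the size bound |U| ≤ |V| + 1, phrased through `D` alone so that it can be
  -- reversed along with `D`.
  Pair⇒ : S → S → Set
  Pair⇒ U V = ∀ {x y} → D U V x → D U V y → x ≢ y → ∃ (D V U)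

  D-≢ : ∀ {I J K x y} → D I J x → D J K y → x ≢ y
  D-≢ p q refl = disjoint p q

  cycle₃ : ∀ {x y z} → x < y → y < z → z < x → ⊥
  cycle₃ p q r = asym (trans-< p q) r

  -- Since B ⊆ A, a suitable pair of elements is ordered oppositely by `V ◁ A` and `B ◁ V`, or by
  -- `U ◁ A` and `B ◁ U`. If j and α both lie in U ∖ V, `pair` first supplies an element of V ∖ U
  -- for the comparison.
  ◁-clash₁ : ∀ {V U A B j α} → V ◁ U → V ◁ A → U ◁ A → B ◁ V → B ◁ U →
    (∀ {x} → ¬ D B A x) → Pair⇒ U V → D B V j → D U A α → ⊥
  ◁-clash₁ {V} {U} {A} {B} {j} {α} V◁U V◁A U◁A B◁V B◁U B⊆A pair j∈B∖V α∈U∖A =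
    final (split V α∈U∖A)
    where
    toA : ∀ {K x} → D B K x → D A K x
    toA p with split A p
    ... | inj₁ q = ⊥-elim (B⊆A q)
    ... | inj₂ q = q
    toB : ∀ {K x} → D K A x → D K B x
    toB p with split B p
    ... | inj₁ q = q
    ... | inj₂ q = ⊥-elim (B⊆A q)
    final : D U V α ⊎ D V A α → ⊥
    final (inj₂ α∈V∖A) = asym (V◁A α∈V∖A (toA j∈B∖V)) (B◁V j∈B∖V (toB α∈V∖A))
    final (inj₁ α∈U∖V) with split U j∈B∖V
    ... | inj₁ j∈B∖U = asym (B◁U j∈B∖U (toB α∈U∖A)) (U◁A α∈U∖A (toA j∈B∖U))
    ... | inj₂ j∈U∖V with pair j∈U∖V α∈U∖V (λ e → D-≢ α∈U∖A (toA j∈B∖V) (sym e))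
    ... | r , r∈V∖U with split B r∈V∖U
    ... | inj₁ r∈V∖B = asym (V◁U r∈V∖U j∈U∖V) (B◁V j∈B∖V r∈V∖B)
    ... | inj₂ r∈B∖U = asym (B◁U r∈B∖U (toB α∈U∖A)) (U◁A α∈U∖A (toA r∈B∖U))

  -- The size bound `balance` yields β in B ∖ U, which also lies in A; then `B ◁ U` and `U ◁ A`
  -- order α and β oppositely.
  ◁-clash₂ : ∀ {U A B α} → U ◁ A → B ◁ U → (∀ {x} → ¬ D B A x) →
    (∀ {x} → D U B x → ∃ (D B U)) → D U A α → ⊥
  ◁-clash₂ {U} {A} {B} U◁A B◁U B⊆A balance α∈U∖A with split B α∈U∖A
  ... | inj₂ α∈B∖A = B⊆A α∈B∖A
  ... | inj₁ α∈U∖B with balance α∈U∖B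
  ... | β , β∈B∖U with split A β∈B∖U
  ... | inj₁ β∈B∖A = B⊆A β∈B∖A
  ... | inj₂ β∈A∖U = asym (B◁U β∈B∖U α∈U∖B) (U◁A α∈U∖A β∈A∖U)

  module _ {V A B j w} (V◁A : V ◁ A) (V-B : NoAlt V B) (A◁B : A ◁ B)
    (j∈B∖V : D B V j) (w∈V∖B : D V B w) (j<w : j < w) (s : ∃ (D A B)) where

    w∈A∖B : D A B w
    w∈A∖B with split A w∈V∖B
    ... | inj₂ p = p
    ... | inj₁ w∈V∖A with split A j∈B∖V
    ... | inj₂ j∈A∖V = ⊥-elim (asym j<w (V◁A w∈V∖A j∈A∖V))
    ... | inj₁ j∈B∖A with split V (proj₂ s)
    ... | inj₁ s∈A∖V = ⊥-elim (cycle₃ (V◁A w∈V∖A s∈A∖V) (A◁B (proj₂ s) j∈B∖A) j<w)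
    ... | inj₂ s∈V∖B = ⊥-elim (V-B (alt s∈V∖B j∈B∖V w∈V∖B (A◁B (proj₂ s) j∈B∖A) j<w))

    j∈A∖V : D A V j
    j∈A∖V with split A j∈B∖V
    ... | inj₂ p = p
    ... | inj₁ j∈B∖A = ⊥-elim (asym j<w (A◁B w∈A∖B j∈B∖A))

    -- An element v of V ∖ A lies left of j. Outside B it gives the alternation v < j < w of V
    -- around B; inside B it would have to lie right of w, by `A ◁ B`.
    V⊆A : ∀ {v} → ¬ D V A v
    V⊆A v∈V∖A with split B v∈V∖A
    ... | inj₁ v∈V∖B = V-B (alt v∈V∖B j∈B∖V w∈V∖B (V◁A v∈V∖A j∈A∖V) j<w)
    ... | inj₂ v∈B∖A = cycle₃ (V◁A v∈V∖A j∈A∖V) j<w (A◁B w∈A∖B v∈B∖A)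

    -- The relations force V ⊆ A, properly because of j, so the bound |A| ≤ |V| fails.
    surround-clash₁ : (∀ {x} → D A V x → ∃ (D V A)) → ⊥
    surround-clash₁ balance = V⊆A (proj₂ (balance j∈A∖V))

    -- Because V ⊆ A, α lies in U ∖ V. If j ∈ U, `pair` gives an element of V ∖ U that has no place.
    -- If j ∉ U, then α < j < w is an alternation of U around B, unless α ∈ B or w ∉ U, and either
    -- of these closes a cycle of inequalities.
    surround-clash₂ : ∀ {U α} → U ◁ A → V ◁ U → NoAlt U B → Pair⇒ U V → D U A α → ⊥
    surround-clash₂ {U} {α} U◁A V◁U U-B pair α∈U∖A = final (split U j∈B∖V)
      where
      α∈U∖V : D U V α
      α∈U∖V with split V α∈U∖A
      ... | inj₁ p = p
      ... | inj₂ p = ⊥-elim (V⊆A p)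
      final : D B U j ⊎ D U V j → ⊥
      final (inj₂ j∈U∖V)
        with pair j∈U∖V α∈U∖V (λ e → D-≢ α∈U∖A j∈A∖V (sym e))
      ... | r , r∈V∖U with split A r∈V∖U
      ... | inj₁ r∈V∖A = V⊆A r∈V∖A
      ... | inj₂ r∈A∖U = asym (U◁A α∈U∖A r∈A∖U) (V◁U r∈V∖U α∈U∖V)
      final (inj₁ j∈B∖U) with split U j∈A∖V
      ... | inj₂ j∈U∖V = disjoint j∈B∖U j∈U∖V
      ... | inj₁ j∈A∖U with split B α∈U∖A | split U w∈V∖B
      ... | inj₂ α∈B∖A | _ = cycle₃ (U◁A α∈U∖A j∈A∖U) j<w (A◁B w∈A∖B α∈B∖A)
      ... | inj₁ α∈U∖B | inj₁ w∈V∖U = cycle₃ (V◁U w∈V∖U α∈U∖V) (U◁A α∈U∖A j∈A∖U) j<w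
      ... | inj₁ α∈U∖B | inj₂ w∈U∖B = U-B (alt α∈U∖B j∈B∖U w∈U∖B (U◁A α∈U∖A j∈A∖U) j<w)

  module _ {V U A B y z j w} (V◁U : V ◁ U) (A◁B : A ◁ B)
    (A-U : NoAlt A U) (A-V : NoAlt A V) (V-B : NoAlt V B) (U-B : NoAlt U B)
    (pair : Pair⇒ U V)
    (y∈U∖A : D U A y) (z∈A∖U : D A U z) (y<z : y < z)
    (j∈B∖V : D B V j) (w∈V∖B : D V B w) (j<w : j < w) where

    -- The position of j relative to y decides which excluded alternation or cycle appears. When j
    -- and y both lie in U ∖ V, `pair` provides the missing point of V ∖ U.
    double-clash-outside : D U B y → D A B z → ⊥
    double-clash-outside y∈U∖B z∈A∖B with split V y∈U∖A
    ... | inj₂ y∈V∖A = final (compare j y)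
      where
      y∈V∖B : D V B y
      y∈V∖B with split V y∈U∖B
      ... | inj₁ y∈U∖V = ⊥-elim (disjoint y∈U∖V y∈V∖A)
      ... | inj₂ p = p
      final : Tri (j < y) (j ≡ y) (y < j) → ⊥
      final (tri> _ _ y<j) = V-B (alt y∈V∖B j∈B∖V w∈V∖B y<j j<w)
      final (tri≈ _ j≡y _) = D-≢ j∈B∖V y∈V∖B j≡y
      final (tri< j<y _ _) with split A j∈B∖V
      ... | inj₁ j∈B∖A = cycle₃ j<y y<z (A◁B z∈A∖B j∈B∖A)
      ... | inj₂ j∈A∖V with split V z∈A∖U | split U j∈A∖V
      ... | inj₁ z∈A∖V | _ = A-V (alt j∈A∖V y∈V∖A z∈A∖V j<y y<z)
      ... | inj₂ z∈V∖U | inj₁ j∈A∖U = A-U (alt j∈A∖U y∈U∖A z∈A∖U j<y y<z)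
      ... | inj₂ z∈V∖U | inj₂ j∈U∖V = cycle₃ (V◁U z∈V∖U j∈U∖V) j<y y<z
    ... | inj₁ y∈U∖V = final (compare j y)
      where
      two : D U V j → ⊥
      two j∈U∖V with pair j∈U∖V y∈U∖V (λ e → D-≢ y∈U∖B j∈B∖V (sym e))
      ... | r , r∈V∖U with split A r∈V∖U
      ... | inj₂ r∈A∖U = A-U (alt r∈A∖U y∈U∖A z∈A∖U (V◁U r∈V∖U y∈U∖V) y<z)
      ... | inj₁ r∈V∖A with split B r∈V∖A
      ... | inj₁ r∈V∖B = V-B (alt r∈V∖B j∈B∖V w∈V∖B (V◁U r∈V∖U j∈U∖V) j<w)
      ... | inj₂ r∈B∖A = cycle₃ (V◁U r∈V∖U y∈U∖V) y<z (A◁B z∈A∖B r∈B∖A)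
      final : Tri (j < y) (j ≡ y) (y < j) → ⊥
      final (tri≈ _ j≡y _) = D-≢ y∈U∖B j∈B∖V (sym j≡y)
      final (tri< j<y _ _) with split A j∈B∖V
      ... | inj₁ j∈B∖A = cycle₃ j<y y<z (A◁B z∈A∖B j∈B∖A)
      ... | inj₂ j∈A∖V with split U j∈A∖V
      ... | inj₁ j∈A∖U = A-U (alt j∈A∖U y∈U∖A z∈A∖U j<y y<z)
      ... | inj₂ j∈U∖V = two j∈U∖V
      final (tri> _ _ y<j) with split U w∈V∖B | split U j∈B∖V
      ... | inj₁ w∈V∖U | _ = cycle₃ (V◁U w∈V∖U y∈U∖V) y<j j<w
      ... | inj₂ w∈U∖B | inj₁ j∈B∖U = U-B (alt y∈U∖B j∈B∖U w∈U∖B y<j j<w)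
      ... | inj₂ w∈U∖B | inj₂ j∈U∖V = two j∈U∖V

    -- The element s of A ∖ B is used to find σ in U ∖ B at or left of y and τ in A ∖ V at or left
    -- of j. Comparing z with w then gives an alternation of U around B or of A around V, or else a
    -- point of V ∖ U at or right of z, which `finish` refutes.
    double-clash-between : D B U z → D V A w → ∃ (D A B) → ⊥
    double-clash-between z∈B∖U w∈V∖A (s , s∈A∖B) with lower | upper
      where
      lower : ∃ λ σ → D U B σ × (σ ≡ y ⊎ σ < y)
      lower with split B y∈U∖A
      ... | inj₁ y∈U∖B = y , y∈U∖B , inj₁ refl
      ... | inj₂ y∈B∖A with split U s∈A∖B
      ... | inj₁ s∈A∖U = ⊥-elim (A-U (alt s∈A∖U y∈U∖A z∈A∖U (A◁B s∈A∖B y∈B∖A) y<z))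
      ... | inj₂ s∈U∖B = s , s∈U∖B , inj₂ (A◁B s∈A∖B y∈B∖A)
      upper : ∃ λ σ → D A V σ × (σ ≡ j ⊎ σ < j)
      upper with split A j∈B∖V
      ... | inj₂ j∈A∖V = j , j∈A∖V , inj₁ refl
      ... | inj₁ j∈B∖A with split V s∈A∖B
      ... | inj₁ s∈A∖V = s , s∈A∖V , inj₂ (A◁B s∈A∖B j∈B∖A)
      ... | inj₂ s∈V∖B = ⊥-elim (V-B (alt s∈V∖B j∈B∖V w∈V∖B (A◁B s∈A∖B j∈B∖A) j<w))
    ... | σ , σ∈U∖B , σ≤y | τ , τ∈A∖V , τ≤j = final (compare z w)
      where
      ≤<-trans : ∀ {a b c} → a ≡ b ⊎ a < b → b < c → a < c
      ≤<-trans (inj₁ refl) q = q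
      ≤<-trans (inj₂ p) q = trans-< p q
      <≤-trans : ∀ {a b c} → a < b → b ≡ c ⊎ b < c → a < c
      <≤-trans p (inj₁ refl) = p
      <≤-trans p (inj₂ q) = trans-< p q
      finish : ∀ {q} → D V U q → z ≡ q ⊎ z < q → ⊥
      finish q∈V∖U z≤q with split V σ∈U∖B
      ... | inj₁ σ∈U∖V = asym (V◁U q∈V∖U σ∈U∖V) (<≤-trans (≤<-trans σ≤y y<z) z≤q)
      ... | inj₂ σ∈V∖B with compare σ j
      ... | tri< σ<j _ _ = V-B (alt σ∈V∖B j∈B∖V w∈V∖B σ<j j<w)
      ... | tri≈ _ σ≡j _ = D-≢ σ∈V∖B j∈B∖V σ≡j
      ... | tri> _ _ j<σ with split U τ∈A∖V
      ... | inj₁ τ∈A∖U = A-U (alt τ∈A∖U y∈U∖A z∈A∖U (≤<-trans τ≤j (<≤-trans j<σ σ≤y)) y<z)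
      ... | inj₂ τ∈U∖V = cycle₃ (V◁U q∈V∖U τ∈U∖V) (≤<-trans τ≤j (<≤-trans j<σ σ≤y)) (<≤-trans y<z z≤q)
      final : Tri (z < w) (z ≡ w) (w < z) → ⊥
      final (tri≈ _ z≡w _) = D-≢ w∈V∖A z∈A∖U (sym z≡w)
      final (tri< z<w _ _) with split U w∈V∖B
      ... | inj₁ w∈V∖U = finish w∈V∖U (inj₂ z<w)
      ... | inj₂ w∈U∖B = U-B (alt σ∈U∖B z∈B∖U w∈U∖B (≤<-trans σ≤y y<z) z<w)
      final (tri> _ _ w<z) with split V z∈A∖U
      ... | inj₁ z∈A∖V = A-V (alt τ∈A∖V w∈V∖A z∈A∖V (≤<-trans τ≤j j<w) w<z)
      ... | inj₂ z∈V∖U = finish z∈V∖U (inj₁ refl)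

    -- The hypothesis `dual` is the instance of `double-clash-outside` for reversed `D`, which
    -- cannot be formed inside this module.
    double-clash : ∃ (D A B) → (D A V j → D A B w → ⊥) → ⊥
    double-clash s dual with split B y∈U∖A | split B z∈A∖U | split A w∈V∖B | split A j∈B∖V
    ... | inj₁ y∈U∖B | inj₁ z∈A∖B | _ | _ = double-clash-outside y∈U∖B z∈A∖B
    ... | inj₂ y∈B∖A | inj₁ z∈A∖B | _ | _ = asym y<z (A◁B z∈A∖B y∈B∖A)
    ... | _ | _ | inj₂ w∈A∖B | inj₂ j∈A∖V = dual j∈A∖V w∈A∖B
    ... | _ | _ | inj₂ w∈A∖B | inj₁ j∈B∖A = asym j<w (A◁B w∈A∖B j∈B∖A)
    ... | _ | inj₂ z∈B∖U | inj₁ w∈V∖A | _ = double-clash-between z∈B∖U w∈V∖A s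

  -- Suppose y < z. If exactly one of y, z lies in T, one of the two given `◁` is violated.
  -- Otherwise the size bounds supply a further point, which violates them or completes an excluded
  -- alternation between Z and Y.
  ◁-compose : ∀ {Z T Y} → Z ◁ T → T ◁ Y →
    NoAlt Y Z ⊎ (NoAlt Z Y × (∀ {x} → D Y T x → ∃ (D T Y))) →
    (∀ {x} → D Z T x → ∃ (D T Z)) → (∀ {x} → D T Z x → ∃ (D Z T)) →
    (∀ {x} → D T Y x → ∃ (D Y T)) → Z ◁ Y
  ◁-compose {Z} {T} {Y} Z◁T T◁Y Y-Z ZT TZ TY {z} {y} z∈Z∖Y y∈Y∖Z with compare z y
  ... | tri< z<y _ _ = z<y
  ... | tri≈ _ z≡y _ = ⊥-elim (D-≢ z∈Z∖Y y∈Y∖Z z≡y)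
  ... | tri> _ _ y<z = ⊥-elim (refute Y-Z (split T z∈Z∖Y) (split T y∈Y∖Z))
    where
    refute : NoAlt Y Z ⊎ (NoAlt Z Y × (∀ {x} → D Y T x → ∃ (D T Y))) →
      D Z T z ⊎ D T Y z → D Y T y ⊎ D T Z y → ⊥
    refute _ (inj₂ z∈T∖Y) (inj₁ y∈Y∖T) = asym y<z (T◁Y z∈T∖Y y∈Y∖T)
    refute _ (inj₁ z∈Z∖T) (inj₂ y∈T∖Z) = asym y<z (Z◁T z∈Z∖T y∈T∖Z)
    refute opt (inj₁ z∈Z∖T) (inj₁ y∈Y∖T) with ZT z∈Z∖T
    ... | τ , τ∈T∖Z with split Y τ∈T∖Z | opt
    ... | inj₁ τ∈T∖Y | _ = cycle₃ y<z (Z◁T z∈Z∖T τ∈T∖Z) (T◁Y τ∈T∖Y y∈Y∖T)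
    ... | inj₂ τ∈Y∖Z | inj₁ n = n (alt y∈Y∖Z z∈Z∖Y τ∈Y∖Z y<z (Z◁T z∈Z∖T τ∈T∖Z))
    ... | inj₂ _ | inj₂ (n , YT) with YT y∈Y∖T
    ... | α , α∈T∖Y with split Z α∈T∖Y
    ... | inj₁ α∈T∖Z = cycle₃ (Z◁T z∈Z∖T α∈T∖Z) (T◁Y α∈T∖Y y∈Y∖T) y<z
    ... | inj₂ α∈Z∖Y = n (alt α∈Z∖Y y∈Y∖Z z∈Z∖Y (T◁Y α∈T∖Y y∈Y∖T) y<z)
    refute opt (inj₂ z∈T∖Y) (inj₂ y∈T∖Z) with TZ y∈T∖Z | TY z∈T∖Y
    ... | ζ , ζ∈Z∖T | η , η∈Y∖T with split Y ζ∈Z∖T | split Z η∈Y∖T | opt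
    ... | inj₂ ζ∈Y∖T | _ | _ = cycle₃ y<z (T◁Y z∈T∖Y ζ∈Y∖T) (Z◁T ζ∈Z∖T y∈T∖Z)
    ... | inj₁ _ | inj₂ η∈Z∖T | _ = cycle₃ y<z (T◁Y z∈T∖Y η∈Y∖T) (Z◁T η∈Z∖T y∈T∖Z)
    ... | inj₁ _ | inj₁ η∈Y∖Z | inj₁ n = n (alt y∈Y∖Z z∈Z∖Y η∈Y∖Z y<z (T◁Y z∈T∖Y η∈Y∖T))
    ... | inj₁ ζ∈Z∖Y | inj₁ _ | inj₂ (n , _) = n (alt ζ∈Z∖Y y∈Y∖Z z∈Z∖Y (Z◁T ζ∈Z∖T y∈T∖Z) y<z)

  -- A point of Z ∖ T left of τ, or right of τ′, would extend one of the given pairs to an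
  -- alternation of Z around T.
  between : ∀ {Z T τ ζ ζ′ τ′} → NoAlt Z T → D T Z τ → D Z T ζ → τ < ζ →
    D Z T ζ′ → D T Z τ′ → ζ′ < τ′ →
    (∀ {ξ} → D Z T ξ → τ < ξ) × (∀ {ξ} → D Z T ξ → ξ < τ′)
  between {Z} {T} {τ} {ζ} {ζ′} {τ′} Z-T τ∈ ζ∈ τ<ζ ζ′∈ τ′∈ ζ′<τ′ = above , below
    where
    above : ∀ {ξ} → D Z T ξ → τ < ξ
    above {ξ} ξ∈ with compare τ ξ
    ... | tri< p _ _ = p
    ... | tri≈ _ e _ = ⊥-elim (D-≢ τ∈ ξ∈ e)
    ... | tri> _ _ ξ<τ = ⊥-elim (Z-T (alt ξ∈ τ∈ ζ∈ ξ<τ τ<ζ))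
    below : ∀ {ξ} → D Z T ξ → ξ < τ′
    below {ξ} ξ∈ with compare ξ τ′
    ... | tri< p _ _ = p
    ... | tri≈ _ e _ = ⊥-elim (D-≢ ξ∈ τ′∈ e)
    ... | tri> _ _ τ′<ξ = ⊥-elim (Z-T (alt ζ′∈ τ′∈ ξ∈ ζ′<τ′ τ′<ξ))

-- Subsets and weak separation

private
  variable
    m : ℕ
    x y e ε μ : Fin m
    I J K X Y G : Subset m
    w : Permutation′ m
    A B : Set

Diff : Subset m → Subset m → Fin m → Set
Diff I J x = x ∈ I × x ∉ J

diff-split : ∀ J → Diff I K x → Diff I J x ⊎ Diff J K x
diff-split {x = x} J (x∈I , x∉K) with x ∈? J
... | yes x∈J = inj₂ (x∈J , x∉K)
... | no x∉J = inj₁ (x∈I , x∉J)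

diff-disjoint : Diff I J x → Diff J K x → ⊥
diff-disjoint (_ , x∉J) (x∈J , _) = x∉J x∈J

module Direct {m} = Patterns {S = Subset m} (<-isStrictTotalOrder {m}) Diff
  diff-split diff-disjoint

module Dual {m} = Patterns {S = Subset m} (<-isStrictTotalOrder {m}) (flip Diff)
  (λ J d → ⊎-swap (diff-split J d)) (flip diff-disjoint)

open Direct using (_◁_; Alt; NoAlt; alt; Pair⇒; D-≢)

infixl 6 _⊕_ _⊖_

_⊕_ : Subset m → Fin m → Subset m
X ⊕ e = X [ e ]≔ inside

_⊖_ : Subset m → Fin m → Subset m
X ⊖ e = X [ e ]≔ outside

∈⊕ : ∀ X (e : Fin m) → e ∈ X ⊕ e
∈⊕ = []≔-updates

∈⊕⁺ : x ∈ X → x ∈ X ⊕ e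
∈⊕⁺ {x = x} {X = X} {e = e} x∈X with x ≟ e
... | yes refl = ∈⊕ X e
... | no x≢e = []≔-minimal X x e x≢e x∈X

update⁻ : ∀ {s} → x ≢ e → x ∈ X [ e ]≔ s → x ∈ X
update⁻ {x = x} {e = e} {X = X} {s} x≢e x∈ =
  lookup⇒[]= x X (trans (sym (lookup∘update′ x≢e X s)) ([]=⇒lookup x∈))

∈⊕⁻ : x ∈ X ⊕ e → x ≡ e ⊎ x ∈ X
∈⊕⁻ {x = x} {e = e} x∈ with x ≟ e
... | yes x≡e = inj₁ x≡e
... | no x≢e = inj₂ (update⁻ x≢e x∈)

∉⊖ : ∀ X (e : Fin m) → e ∉ X ⊖ e
∉⊖ X e e∈ with () ← trans (sym (lookup∘update e X outside)) ([]=⇒lookup e∈)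

⊖-≢ : x ∈ X ⊖ e → x ≢ e
⊖-≢ {X = X} x∈ refl = ∉⊖ X _ x∈

∈⊖⁻ : x ∈ X ⊖ e → x ∈ X
∈⊖⁻ {X = X} x∈ = update⁻ (⊖-≢ {X = X} x∈) x∈

∈⊖⁺ : x ∈ X → x ≢ e → x ∈ X ⊖ e
∈⊖⁺ {x = x} {X = X} {e = e} x∈X x≢e = []≔-minimal X x e x≢e x∈X

∉⊕ : x ∉ X → x ≢ e → x ∉ X ⊕ e
∉⊕ x∉X x≢e x∈ = x∉X (update⁻ x≢e x∈)

∉⊕⁻ : x ∉ X ⊕ e → x ∉ X
∉⊕⁻ x∉ x∈ = x∉ (∈⊕⁺ x∈)

⊖-absent : e ∉ X → X ⊖ e ≡ X
⊖-absent {X = X} e∉X = ⊆-antisym (∈⊖⁻ {X = X}) (λ x∈ → ∈⊖⁺ x∈ λ { refl → e∉X x∈ })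

⊕⊖ : e ∉ X → (X ⊕ e) ⊖ e ≡ X
⊕⊖ {e = e} {X = X} e∉X = ⊆-antisym
  (λ x∈ → update⁻ (⊖-≢ {X = X ⊕ e} x∈) (∈⊖⁻ {X = X ⊕ e} x∈))
  (λ x∈ → ∈⊖⁺ (∈⊕⁺ x∈) λ { refl → e∉X x∈ })

⊖⊕ : e ∈ X → (X ⊖ e) ⊕ e ≡ X
⊖⊕ {e = e} {X = X} e∈X = ⊆-antisym
  (λ x∈ → [ (λ { refl → e∈X }) , ∈⊖⁻ {X = X} ]′ (∈⊕⁻ x∈)) back
  where
  back : ∀ {x} → x ∈ X → x ∈ (X ⊖ e) ⊕ e
  back {x} x∈ with x ≟ e
  ... | yes refl = ∈⊕ (X ⊖ e) e
  ... | no x≢e = ∈⊕⁺ (∈⊖⁺ x∈ x≢e)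

∣⊕∣ : ∀ {m} {X : Subset m} {e} → e ∉ X → ∣ X ⊕ e ∣ ≡ suc ∣ X ∣
∣⊕∣ {X = inside ∷ X} {zero} e∉X = contradiction here e∉X
∣⊕∣ {X = outside ∷ X} {zero} e∉X = refl
∣⊕∣ {X = inside ∷ X} {suc e} e∉X = cong suc (∣⊕∣ (e∉X ∘ there))
∣⊕∣ {X = outside ∷ X} {suc e} e∉X = ∣⊕∣ (e∉X ∘ there)

∣⊖∣ : e ∈ X → ∣ X ∣ ≡ suc ∣ X ⊖ e ∣
∣⊖∣ {e = e} {X = X} e∈X = trans (cong ∣_∣ (sym (⊖⊕ e∈X))) (∣⊕∣ (∉⊖ X e))

balance : ∣ I ∣ ℕ.≤ ∣ J ∣ → Diff I J x → ∃ (Diff J I)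
balance {I = I} {J = J} {x = x} I≤J (x∈I , x∉J) with any? (λ y → (y ∈? J) ×-dec ¬? (y ∈? I))
... | yes p = p
... | no ∄ = contradiction (p⊂q⇒∣p∣<∣q∣ (J⊆I , x , x∈I , x∉J)) (ℕ.≤⇒≯ I≤J)
  where
  J⊆I : J ⊆ I
  J⊆I {y} y∈J with y ∈? I
  ... | yes y∈I = y∈I
  ... | no y∉I = contradiction (y , y∈J , y∉I) ∄

excess : ∣ I ∣ ℕ.< ∣ J ∣ → ∃ (Diff J I)
excess {I = I} {J = J} I<J with any? (λ y → (y ∈? J) ×-dec ¬? (y ∈? I))
... | yes p = p
... | no ∄ = contradiction (p⊆q⇒∣p∣≤∣q∣ J⊆I) (ℕ.<⇒≱ I<J)
  where
  J⊆I : J ⊆ I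
  J⊆I {y} y∈J with y ∈? I
  ... | yes y∈I = y∈I
  ... | no y∉I = contradiction (y , y∈J , y∉I) ∄

nonempty : 0 ℕ.< ∣ G ∣ → Nonempty G
nonempty {m} {G} 0<G =
  let x , x∈G , _ = excess {I = Subset.⊥} {J = G} (subst (ℕ._< ∣ G ∣) (sym (∣⊥∣≡0 m)) 0<G) in x , x∈G

pair-balance : ∣ I ∣ ℕ.≤ suc ∣ J ∣ → Pair⇒ I J
pair-balance {I = I} {J = J} I≤J {x} (x∈I , x∉J) (y∈I , y∉J) x≢y
  with balance (ℕ.s≤s⁻¹ (subst (ℕ._≤ _) (∣⊖∣ x∈I) I≤J)) (∈⊖⁺ y∈I (x≢y ∘ sym) , y∉J)
... | z , z∈J , z∉ = z , z∈J , λ z∈I → z∉ (∈⊖⁺ z∈I λ { refl → x∉J z∈J })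

-- Deleting c from J costs at most one element, which is the slack that `pair-balance` tolerates.
balance-avoid : ∣ I ∣ ℕ.≤ ∣ J ∣ → Diff I J x → Diff I J y → x ≢ y → ∀ c →
  ∃ λ z → Diff J I z × z ≢ c
balance-avoid {I = I} {J = J} I≤J (x∈I , x∉J) (y∈I , y∉J) x≢y c
  with pair-balance {I = I} {J = J ⊖ c} (ℕ.≤-trans I≤J J≤)
         (x∈I , x∉J ∘ ∈⊖⁻ {X = J}) (y∈I , y∉J ∘ ∈⊖⁻ {X = J}) x≢y
  where
  J≤ : ∣ J ∣ ℕ.≤ suc ∣ J ⊖ c ∣
  J≤ with c ∈? J
  ... | yes c∈J = ℕ.≤-reflexive (∣⊖∣ c∈J)
  ... | no c∉J = ℕ.≤-trans (ℕ.≤-reflexive (cong ∣_∣ (sym (⊖-absent c∉J)))) (ℕ.n≤1+n _)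
... | z , z∈J , z∉I = z , (∈⊖⁻ {X = J} z∈J , z∉I) , ⊖-≢ {X = J} z∈J

diff? : ∀ (I J : Subset m) x → Dec (Diff I J x)
diff? I J x = (x ∈? I) ×-dec ¬? (x ∈? J)

alt? : ∀ (I J : Subset m) → Dec (Alt I J)
alt? I J = any? λ x → any? λ y → any? λ z →
  diff? I J x ×-dec diff? J I y ×-dec diff? I J z ×-dec (x <? y) ×-dec (y <? z)

¬NoAlt⇒Alt : ∀ (I J : Subset m) → ¬ NoAlt I J → Alt I J
¬NoAlt⇒Alt I J = decidable-stable (alt? I J)

-- Weak separation with the partition replaced by `NoAlt`; `weaklySeparated⁻` and `weaklySeparated⁺`
-- translate.
WS : Subset m → Subset m → Set
WS I J = (∣ J ∣ ℕ.≤ ∣ I ∣ × NoAlt I J) ⊎ (∣ I ∣ ℕ.≤ ∣ J ∣ × NoAlt J I)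

ws-sym : WS I J → WS J I
ws-sym = ⊎-swap

noAlt? : ∀ (I J : Subset m) → Dec (NoAlt I J)
noAlt? I J = ¬? (alt? I J)

ws? : ∀ (I J : Subset m) → Dec (WS I J)
ws? I J = ((∣ J ∣ ℕ.≤? ∣ I ∣) ×-dec noAlt? I J) ⊎-dec ((∣ I ∣ ℕ.≤? ∣ J ∣) ×-dec noAlt? J I)

ws-noAlt : WS I J → ∣ J ∣ ℕ.< ∣ I ∣ → NoAlt I J
ws-noAlt (inj₁ (_ , n)) _ = n
ws-noAlt (inj₂ (I≤J , _)) J<I = contradiction I≤J (ℕ.<⇒≱ J<I)

both-noAlt⇒ws : NoAlt I J → NoAlt J I → WS I J
both-noAlt⇒ws {I = I} {J = J} p q with ℕ.≤-total ∣ J ∣ ∣ I ∣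
... | inj₁ J≤I = inj₁ (J≤I , p)
... | inj₂ I≤J = inj₂ (I≤J , q)

◁⇒ws : I ◁ J → WS I J
◁⇒ws I◁J = both-noAlt⇒ws
  (λ (_ , _ , _ , p , q , r , s , t) → <-asym t (I◁J r q))
  (λ (_ , _ , _ , p , q , r , s , t) → <-asym s (I◁J q p))

all-ws? : ∀ X (C : List (Subset m)) →
  (∀ {J} → J List.∈ C → WS X J) ⊎ ∃ λ J → J List.∈ C × ¬ WS X J
all-ws? X [] = inj₁ λ ()
all-ws? X (J ∷ C) with ws? X J | all-ws? X C
... | no ¬ws | _ = inj₂ (J , here refl , ¬ws)
... | yes _ | inj₂ (J′ , J′∈C , ¬ws) = inj₂ (J′ , there J′∈C , ¬ws)
... | yes ws | inj₁ all = inj₁ λ { (here refl) → ws ; (there J∈C) → all J∈C }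

Top Bot : Fin m → Subset m → Set
Top μ G = ∀ {x} → x ∈ G → x ≢ μ → x < μ
Bot ε G = ∀ {x} → x ∈ G → x ≢ ε → ε < x

minimum : ∀ {m} {G : Subset m} → Nonempty G → ∃ λ ε → ε ∈ G × Bot ε G
minimum {G = inside ∷ G} _ = zero , here , λ { {zero} _ x≢ → contradiction refl x≢ ; {suc x} _ _ → s≤s z≤n }
minimum {G = outside ∷ G} (suc x , there x∈G) with minimum (x , x∈G)
... | ε , ε∈G , bot = suc ε , there ε∈G ,
  λ { {suc y} (there y∈G) y≢ → s≤s (bot y∈G (y≢ ∘ cong suc)) }

maximum : ∀ {m} {G : Subset m} → Nonempty G → ∃ λ μ → μ ∈ G × Top μ G
maximum {G = s ∷ G} ne with nonempty? G
... | yes ne′ with maximum ne′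
... | μ , μ∈G , top = suc μ , there μ∈G ,
  λ { {zero} _ _ → s≤s z≤n ; {suc y} (there y∈G) y≢ → s≤s (top y∈G (y≢ ∘ cong suc)) }
maximum {G = s ∷ G} (suc x , there x∈G) | no ∄ = contradiction (x , x∈G) ∄
maximum {G = inside ∷ G} (zero , here) | no ∄ = zero , here ,
  λ { {zero} _ x≢ → contradiction refl x≢ ; {suc x} (there x∈G) _ → contradiction (x , x∈G) ∄ }

⊖-diff : Diff (I ⊖ e) (J ⊖ e) x → Diff I J x × x ≢ e
⊖-diff {I = I} (x∈ , x∉) = (∈⊖⁻ {X = I} x∈ , λ x∈J → x∉ (∈⊖⁺ x∈J x≢e)) , x≢e
  where x≢e = ⊖-≢ {X = I} x∈

⊖-noAlt : NoAlt I J → NoAlt (I ⊖ e) (J ⊖ e)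
⊖-noAlt n (_ , _ , _ , p , q , r , s , t) =
  n (alt (proj₁ (⊖-diff p)) (proj₁ (⊖-diff q)) (proj₁ (⊖-diff r)) s t)

module _ (e : Fin m) where

  private
    one-sided : (∀ {I J} → I ⊆ G → J ⊆ G → NoAlt I J → Diff I J e → NoAlt (J ⊖ e) (I ⊖ e)) →
      I ⊆ G → J ⊆ G → e ∈ I → e ∉ J → WS I J → WS (I ⊖ e) (J ⊖ e)
    one-sided {I = I} {J = J} key I⊆G J⊆G e∈I e∉J ws with ⊖-absent e∉J | ws
    ... | eq | inj₂ (I≤J , n) = inj₂ (subst (∣ I ⊖ e ∣ ℕ.≤_) (sym (cong ∣_∣ eq))
        (ℕ.≤-trans (ℕ.n≤1+n _) (subst (ℕ._≤ ∣ J ∣) (∣⊖∣ e∈I) I≤J)) , ⊖-noAlt n)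
    ... | eq | inj₁ (J≤I , n) with ∣ J ∣ ℕ.≤? ∣ I ⊖ e ∣
    ... | yes J≤ = inj₁ (subst (ℕ._≤ ∣ I ⊖ e ∣) (sym (cong ∣_∣ eq)) J≤ , ⊖-noAlt n)
    ... | no J≰ = inj₂ (subst (∣ I ⊖ e ∣ ℕ.≤_) (sym (cong ∣_∣ eq)) (ℕ.<⇒≤ (ℕ.≰⇒> J≰)) ,
        key I⊆G J⊆G n (e∈I , e∉J))

  -- Deleting e from just one of the two sets can reverse the size comparison, but only if the sizes
  -- were equal; `key` then provides `NoAlt` in the new direction.
  ⊖-ws : (∀ {I J} → I ⊆ G → J ⊆ G → NoAlt I J → Diff I J e → NoAlt (J ⊖ e) (I ⊖ e)) →
    I ⊆ G → J ⊆ G → WS I J → WS (I ⊖ e) (J ⊖ e)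
  ⊖-ws {I = I} {J = J} key I⊆G J⊆G ws with e ∈? I | e ∈? J
  ... | yes e∈I | no e∉J = one-sided key I⊆G J⊆G e∈I e∉J ws
  ... | no e∉I | yes e∈J = ws-sym (one-sided key J⊆G I⊆G e∈J e∉I (ws-sym ws))
  ... | no e∉I | no e∉J = subst₂ WS (sym (⊖-absent e∉I)) (sym (⊖-absent e∉J)) ws
  ... | yes e∈I | yes e∈J = [ (λ (p , n) → inj₁ (shrink e∈I e∈J p , ⊖-noAlt n))
                            , (λ (p , n) → inj₂ (shrink e∈J e∈I p , ⊖-noAlt n)) ]′ ws
    where
    shrink : ∀ {I J} → e ∈ I → e ∈ J → ∣ J ∣ ℕ.≤ ∣ I ∣ → ∣ J ⊖ e ∣ ℕ.≤ ∣ I ⊖ e ∣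
    shrink e∈I e∈J p = ℕ.s≤s⁻¹ (subst₂ ℕ._≤_ (∣⊖∣ e∈J) (∣⊖∣ e∈I) p)

-- As e is greatest, an alternation x < y < z of J around I would give the alternation y < z < e of
-- I around J.
⊖-top-ws : Top e G → I ⊆ G → J ⊆ G → WS I J → WS (I ⊖ e) (J ⊖ e)
⊖-top-ws {e = e} top = ⊖-ws e λ I⊆G J⊆G n d (_ , _ , _ , p , q , r , s , t) →
  n (alt (proj₁ (⊖-diff q)) (proj₁ (⊖-diff r)) d t
    (top (J⊆G (proj₁ (proj₁ (⊖-diff r)))) (proj₂ (⊖-diff r))))

⊖-bot-ws : Bot e G → I ⊆ G → J ⊆ G → WS I J → WS (I ⊖ e) (J ⊖ e)
⊖-bot-ws {e = e} bot = ⊖-ws e λ I⊆G J⊆G n d (_ , _ , _ , p , q , r , s , t) →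
  n (alt d (proj₁ (⊖-diff p)) (proj₁ (⊖-diff q))
    (bot (J⊆G (proj₁ (proj₁ (⊖-diff p)))) (proj₂ (⊖-diff p))) s)

⊖-ws⁻ : e ∈ I → e ∈ J → WS (I ⊖ e) (J ⊖ e) → WS I J
⊖-ws⁻ {e = e} e∈I e∈J =
  [ (λ (p , n) → inj₁ (grow e∈I e∈J p , lift e∈I e∈J n))
  , (λ (p , n) → inj₂ (grow e∈J e∈I p , lift e∈J e∈I n)) ]′
  where
  grow : ∀ {I J} → e ∈ I → e ∈ J → ∣ J ⊖ e ∣ ℕ.≤ ∣ I ⊖ e ∣ → ∣ J ∣ ℕ.≤ ∣ I ∣
  grow e∈I e∈J p = subst₂ ℕ._≤_ (sym (∣⊖∣ e∈J)) (sym (∣⊖∣ e∈I)) (s≤s p)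
  diff : ∀ {I J x} → e ∈ J → Diff I J x → Diff (I ⊖ e) (J ⊖ e) x
  diff {J = J} e∈J (x∈ , x∉) = ∈⊖⁺ x∈ (λ { refl → x∉ e∈J }) , x∉ ∘ ∈⊖⁻ {X = J}
  lift : ∀ {I J} → e ∈ I → e ∈ J → NoAlt (I ⊖ e) (J ⊖ e) → NoAlt I J
  lift e∈I e∈J n (_ , _ , _ , p , q , r , s , t) =
    n (alt (diff e∈J p) (diff e∈I q) (diff e∈J r) s t)

-- Enlarging a doubled set

Pairwise : List (Subset m) → Set
Pairwise C = ∀ {I J} → I List.∈ C → J List.∈ C → WS I J

⊕-⊆ : ∀ {e} → X ⊆ G → e ∈ G → X ⊕ e ⊆ G
⊕-⊆ X⊆G e∈G x∈ with ∈⊕⁻ x∈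
... | inj₁ refl = e∈G
... | inj₂ x∈X = X⊆G x∈X

⊖-⊆ : ∀ {e : Fin m} → X ⊆ G → X ⊖ e ⊆ G ⊖ e
⊖-⊆ {X = X} X⊆G x∈ = ∈⊖⁺ (X⊆G (∈⊖⁻ {X = X} x∈)) (⊖-≢ {X = X} x∈)

top-≢ : ∀ {μ x y : Fin m} → Top μ G → y ∈ G → y ≢ μ → x < y → x ≢ μ
top-≢ top y∈G y≢μ x<y refl = <-asym x<y (top y∈G y≢μ)

bot-≢ : ∀ {ε x y : Fin m} → Bot ε G → x ∈ G → x < y → y ≢ ε
bot-≢ {ε = ε} {x} bot x∈G x<y refl with x ≟ ε
... | yes refl = <-irrefl refl x<y
... | no x≢ε = <-asym x<y (bot x∈G x≢ε)

-- `T ⊕ μ` is strictly larger than J, which fixes the direction of separation even if |J| = |T|; and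
-- μ is never a middle point.
noAlt-top : ∀ {μ} {T : Subset m} → Top μ G → T ⊆ G → μ ∉ T →
  WS (T ⊕ μ) J → ∣ J ∣ ℕ.≤ ∣ T ∣ → NoAlt T J
noAlt-top {J = J} top T⊆G μ∉T ws J≤T (_ , _ , _ , (x∈T , x∉J) , (y∈J , y∉T) , (z∈T , z∉J) , x<y , y<z) =
  ws-noAlt ws (subst (∣ J ∣ ℕ.<_) (sym (∣⊕∣ μ∉T)) (s≤s J≤T))
    (alt (∈⊕⁺ x∈T , x∉J) (y∈J , ∉⊕ y∉T (top-≢ top (T⊆G z∈T) (λ { refl → μ∉T z∈T }) y<z))
      (∈⊕⁺ z∈T , z∉J) x<y y<z)

-- If |J| ≤ |X| and ε ∈ J, then `J ⊖ ε` is strictly smaller than X, so the direction is fixed, and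
-- putting ε back creates no middle point because ε is least.
bot-block∈ : Bot ε G → X ⊆ G → WS X (J ⊖ ε) → ¬ WS X J → ε ∈ J × ∣ X ∣ ℕ.< ∣ J ∣
bot-block∈ {ε = ε} {X = X} {J = J} bot X⊆G ws ¬ws with ε ∈? J
... | no ε∉J = contradiction (subst (WS X) (⊖-absent ε∉J) ws) ¬ws
... | yes ε∈J = ε∈J , ℕ.≰⇒> λ J≤X → ¬ws (inj₁ (J≤X , n J≤X))
  where
  n : ∣ J ∣ ℕ.≤ ∣ X ∣ → NoAlt X J
  n J≤X (_ , _ , _ , (x∈ , x∉) , (y∈ , y∉) , (z∈ , z∉) , x<y , y<z) =
    ws-noAlt ws (subst (ℕ._≤ ∣ X ∣) (∣⊖∣ ε∈J) J≤X)
      (alt (x∈ , x∉ ∘ ∈⊖⁻ {X = J}) (∈⊖⁺ y∈ (bot-≢ bot (X⊆G x∈) x<y) , y∉)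
        (z∈ , z∉ ∘ ∈⊖⁻ {X = J}) x<y y<z)

bot-block∉ : Bot ε G → J ⊆ G → ε ∉ X → WS X (J ⊖ ε) → ¬ WS (X ⊕ ε) J →
  ε ∉ J × ∣ J ∣ ℕ.≤ ∣ X ∣
bot-block∉ {ε = ε} {J = J} {X = X} bot J⊆G ε∉X ws ¬ws with ε ∈? J
... | yes ε∈J = contradiction
  (⊖-ws⁻ (∈⊕ X ε) ε∈J (subst (λ X → WS X (J ⊖ ε)) (sym (⊕⊖ ε∉X)) ws)) ¬ws
... | no ε∉J = ε∉J , ℕ.≮⇒≥ λ X<J → ¬ws (inj₂ (subst (ℕ._≤ ∣ J ∣) (sym (∣⊕∣ ε∉X)) X<J , n X<J))
  where
  n : ∣ X ∣ ℕ.< ∣ J ∣ → NoAlt J (X ⊕ ε)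
  n X<J (_ , _ , _ , (x∈ , x∉) , (y∈ , y∉) , (z∈ , z∉) , x<y , y<z) =
    ws-noAlt (ws-sym (subst (WS X) (⊖-absent ε∉J) ws)) X<J
      (alt (x∈ , ∉⊕⁻ x∉) (update⁻ (bot-≢ bot (J⊆G x∈) x<y) y∈ , y∉) (z∈ , ∉⊕⁻ z∉) x<y y<z)

module _ {G T : Subset m} {ε μ c : Fin m} (bot : Bot ε G) (top : Top μ G)
  (T⊆G : T ⊆ G) (μ∉T : μ ∉ T) (c∈G : c ∈ G) (c∉T : c ∉ T) (c≢μ : c ≢ μ) where

  -- Lifts c from `G ⊖ ε` to G when ε ∈ T. For |J| ≤ |T|, an alternation of `T ⊕ c` around J must
  -- end at c, since one ending in T could be started at ε inside T.
  ⊕-ws-bot∈ : ε ∈ T → J ⊆ G → ε ∉ J → WS T J → WS (T ⊕ μ) J →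
    WS ((T ⊖ ε) ⊕ c) J → WS (T ⊕ c) J
  ⊕-ws-bot∈ {J} ε∈T J⊆G ε∉J wsT wsTμ wsT₀c with ∣ J ∣ ℕ.≤? ∣ T ∣
  ... | no J≰T = inj₂ (subst (ℕ._≤ ∣ J ∣) (sym (∣⊕∣ c∉T)) T<J , n)
    where
    T<J = ℕ.≰⇒> J≰T
    size : ∣ (T ⊖ ε) ⊕ c ∣ ≡ ∣ T ∣
    size = trans (∣⊕∣ (c∉T ∘ ∈⊖⁻ {X = T})) (sym (∣⊖∣ ε∈T))
    drop : ∀ {x} → x ∉ T ⊕ c → x ∉ (T ⊖ ε) ⊕ c
    drop x∉ x∈ with ∈⊕⁻ x∈
    ... | inj₁ refl = x∉ (∈⊕ T c)
    ... | inj₂ x∈T = x∉ (∈⊕⁺ (∈⊖⁻ {X = T} x∈T))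
    n : NoAlt J (T ⊕ c)
    n (_ , _ , _ , (x∈ , x∉) , (y∈ , y∉) , (z∈ , z∉) , x<y , y<z) with ∈⊕⁻ y∈
    ... | inj₂ y∈T = ws-noAlt (ws-sym wsT) T<J
      (alt (x∈ , ∉⊕⁻ x∉) (y∈T , y∉) (z∈ , ∉⊕⁻ z∉) x<y y<z)
    ... | inj₁ refl = ws-noAlt (ws-sym wsT₀c) (subst (ℕ._< ∣ J ∣) (sym size) T<J)
      (alt (x∈ , drop x∉) (∈⊕ (T ⊖ ε) c , y∉) (z∈ , drop z∉) x<y y<z)
  ... | yes J≤T = inj₁ (subst (∣ J ∣ ℕ.≤_) (sym (∣⊕∣ c∉T)) (ℕ.m≤n⇒m≤1+n J≤T) , n)
    where
    T-J : NoAlt T J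
    T-J = noAlt-top top T⊆G μ∉T wsTμ J≤T
    ε∈ : Diff T J ε
    ε∈ = ε∈T , ε∉J
    n : NoAlt (T ⊕ c) J
    n (_ , j , z , _ , (j∈J , j∉) , (z∈ , z∉) , _ , j<z) = go (∈⊕⁻ z∈)
      where
      j∈ : Diff J T j
      j∈ = j∈J , ∉⊕⁻ j∉
      ε<j : ε < j
      ε<j = bot (J⊆G j∈J) λ { refl → ε∉J j∈J }
      j<μ : j < μ
      j<μ with z ≟ μ
      ... | yes refl = j<z
      ... | no z≢μ = <-trans j<z (top (⊕-⊆ T⊆G c∈G z∈) z≢μ)
      T₀c : ∀ {x} → x ∈ T → x ≢ ε → x ∈ (T ⊖ ε) ⊕ c
      T₀c x∈T x≢ε = ∈⊕⁺ (∈⊖⁺ x∈T x≢ε)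
      j∉T₀c : j ∉ (T ⊖ ε) ⊕ c
      j∉T₀c = ∉⊕ (proj₂ j∈ ∘ ∈⊖⁻ {X = T}) λ { refl → j∉ (∈⊕ T c) }
      μ∈J : μ ∈ J
      μ∈J with μ ∈? J
      ... | yes p = p
      ... | no μ∉J = ⊥-elim (ws-noAlt wsTμ (subst (∣ J ∣ ℕ.<_) (sym (∣⊕∣ μ∉T)) (s≤s J≤T))
        (alt (∈⊕⁺ ε∈T , ε∉J) (j∈J , ∉⊕ (proj₂ j∈) λ { refl → <-irrefl refl j<μ })
          (∈⊕ T μ , μ∉J) ε<j j<μ))
      go : z ≡ c ⊎ z ∈ T → ⊥
      go (inj₂ z∈T) = T-J (alt ε∈ j∈ (z∈T , z∉) ε<j j<z)
      -- Both j and μ lie in J ∖ T, so T ∖ J contains some α besides ε. It must lie left of j, and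
      -- then α < j < c and j < c < μ rule out both directions of separation between `(T ⊖ ε) ⊕ c`
      -- and J.
      go (inj₁ refl) with balance-avoid J≤T j∈ (μ∈J , μ∉T) (λ { refl → <-irrefl refl j<μ }) ε
      ... | α , α∈ , α≢ε with <-cmp α j
      ... | tri> _ _ j<α = T-J (alt ε∈ j∈ α∈ ε<j j<α)
      ... | tri≈ _ refl _ = D-≢ α∈ j∈ refl
      ... | tri< α<j _ _ =
        [ (λ (_ , T₀c-J) → T₀c-J (alt (T₀c (proj₁ α∈) α≢ε , proj₂ α∈) (j∈J , j∉T₀c)
              (∈⊕ (T ⊖ ε) c , z∉) α<j j<z))
        , (λ (_ , J-T₀c) → J-T₀c (alt (j∈J , j∉T₀c) (∈⊕ (T ⊖ ε) c , z∉)
              (μ∈J , ∉⊕ (μ∉T ∘ ∈⊖⁻ {X = T}) (c≢μ ∘ sym)) j<z (top c∈G c≢μ))) ]′ wsT₀c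

  -- When ε ∉ T, one of `T ⊕ c` and `T ⊕ ε` can be added. Otherwise an obstruction `J₁` to the first
  -- is large and contains ε, an obstruction `J₂` to the second is small and omits ε, and these two
  -- are not separated.
  ⊕-ws-bot∉ : ∀ {J₁ J₂} → ε ∉ T → J₂ ⊆ G → WS T J₁ → WS T J₂ → WS (T ⊕ μ) J₂ → WS J₁ J₂ →
    WS (T ⊕ c) (J₁ ⊖ ε) → WS (T ⊕ c) (J₂ ⊖ ε) → ¬ WS (T ⊕ c) J₁ → ¬ WS (T ⊕ ε) J₂ → ⊥
  ⊕-ws-bot∉ {J₁} {J₂} ε∉T J₂⊆G wsTJ₁ wsTJ₂ wsTμ ws₁₂ wsc₁ wsc₂ ¬ws₁ ¬ws₂ = main gap
    where
    block₁ : ε ∈ J₁ × ∣ T ⊕ c ∣ ℕ.< ∣ J₁ ∣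
    block₁ = bot-block∈ bot (⊕-⊆ T⊆G c∈G) wsc₁ ¬ws₁

    ε∈J₁ : ε ∈ J₁
    ε∈J₁ = proj₁ block₁

    Tc<J₁ : ∣ T ⊕ c ∣ ℕ.< ∣ J₁ ∣
    Tc<J₁ = proj₂ block₁

    block₂ : ε ∉ J₂ × ∣ J₂ ∣ ℕ.≤ ∣ T ∣
    block₂ = bot-block∉ bot J₂⊆G ε∉T
      (subst (λ X → WS X (J₂ ⊖ ε)) (⊖-absent ε∉T) (⊖-bot-ws bot T⊆G J₂⊆G wsTJ₂)) ¬ws₂

    ε∉J₂ : ε ∉ J₂
    ε∉J₂ = proj₁ block₂

    J₂≤T : ∣ J₂ ∣ ℕ.≤ ∣ T ∣
    J₂≤T = proj₂ block₂

    T<J₁ : ∣ T ∣ ℕ.< ∣ J₁ ∣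
    T<J₁ = ℕ.<-trans (ℕ.≤-reflexive (sym (∣⊕∣ c∉T))) Tc<J₁

    J₁-T : NoAlt J₁ T
    J₁-T = ws-noAlt (ws-sym wsTJ₁) T<J₁

    gap : c ∉ J₁ × ∃ λ x → Diff J₁ T x × c < x
    gap with ¬NoAlt⇒Alt J₁ (T ⊕ c) (λ n → ¬ws₁ (inj₂ (ℕ.<⇒≤ Tc<J₁ , n)))
    ... | _ , _ , z , (x∈ , x∉) , (y∈ , y∉) , (z∈ , z∉) , x<y , y<z with ∈⊕⁻ y∈
    ... | inj₂ y∈T = ⊥-elim (J₁-T (alt (x∈ , ∉⊕⁻ x∉) (y∈T , y∉) (z∈ , ∉⊕⁻ z∉) x<y y<z))
    ... | inj₁ refl = y∉ , z , (z∈ , ∉⊕⁻ z∉) , y<z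

    -- A second such element would place c between two elements of `J₁ ⊖ ε`. That leaves only the
    -- direction in which `T ⊕ c` is at least as large, and its balancing element α produces an
    -- alternation wherever it lies.
    below-c : ∀ {x′} → c ∉ J₁ → Diff J₁ T x′ → c < x′ → ∀ {x} → Diff J₁ T x → x < c → x ≡ ε
    below-c {x′} c∉J₁ x′∈ c<x′ {x} x∈ x<c with x ≟ ε
    ... | yes p = p
    ... | no x≢ε = ⊥-elim (refute wsc₁)
      where
      x<x′ : x < x′
      x<x′ = <-trans x<c c<x′
      up : ∀ {y} → Diff J₁ T y → y ≢ ε → y ≢ c → Diff (J₁ ⊖ ε) (T ⊕ c) y
      up (y∈ , y∉) y≢ε y≢c = ∈⊖⁺ y∈ y≢ε , ∉⊕ y∉ y≢c
      x∈′ : Diff (J₁ ⊖ ε) (T ⊕ c) x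
      x∈′ = up x∈ x≢ε λ { refl → <-irrefl refl x<c }
      x′∈′ : Diff (J₁ ⊖ ε) (T ⊕ c) x′
      x′∈′ = up x′∈ (bot-≢ bot c∈G c<x′) λ { refl → <-irrefl refl c<x′ }
      c∈′ : Diff (T ⊕ c) (J₁ ⊖ ε) c
      c∈′ = ∈⊕ T c , c∉J₁ ∘ ∈⊖⁻ {X = J₁}
      refute : WS (T ⊕ c) (J₁ ⊖ ε) → ⊥
      refute (inj₂ (_ , n)) = n (alt x∈′ c∈′ x′∈′ x<c c<x′)
      refute (inj₁ (J₁⊖ε≤Tc , n)) with balance-avoid J₁⊖ε≤Tc x∈′ x′∈′ (λ e → <-irrefl e x<x′) c
      ... | α , α∈′@(α∈Tc , α∉) , α≢c = place (<-cmp α x) (<-cmp α x′)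
        where
        α∈T : α ∈ T
        α∈T = [ (λ e → contradiction e α≢c) , (λ p → p) ]′ (∈⊕⁻ α∈Tc)
        α∈ : Diff T J₁ α
        α∈ = α∈T , λ α∈J₁ → α∉ (∈⊖⁺ α∈J₁ λ { refl → ε∉T α∈T })
        place : Tri (α < x) (α ≡ x) (x < α) → Tri (α < x′) (α ≡ x′) (x′ < α) → ⊥
        place (tri< α<x _ _) _ = n (alt α∈′ x∈′ c∈′ α<x x<c)
        place (tri≈ _ α≡x _) _ = D-≢ α∈ x∈ α≡x
        place _ (tri≈ _ α≡x′ _) = D-≢ α∈ x′∈ α≡x′
        place _ (tri> _ _ x′<α) = n (alt c∈′ x′∈′ α∈′ c<x′ x′<α)
        place (tri> _ _ x<α) (tri< α<x′ _ _) = J₁-T (alt x∈ α∈ x′∈ x<α α<x′)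

    main : c ∉ J₁ × (∃ λ x → Diff J₁ T x × c < x) → ⊥
    main (c∉J₁ , _ , x′∈ , c<x′) with ¬NoAlt⇒Alt (T ⊕ ε) J₂ (λ n → ¬ws₂ (inj₁
                    (subst (∣ J₂ ∣ ℕ.≤_) (sym (∣⊕∣ ε∉T)) (ℕ.m≤n⇒m≤1+n J₂≤T) , n)))
    ... | _ , β , α , _ , (β∈J₂ , β∉) , (α∈ , α∉) , _ , β<α = choose (<-cmp β c)
      where
      β∈ : Diff J₂ T β
      β∈ = β∈J₂ , ∉⊕⁻ β∉
      α∈′ : Diff T J₂ α
      α∈′ = update⁻ (bot-≢ bot (J₂⊆G β∈J₂) β<α) α∈ , α∉
      below-β : ∀ {x} → Diff T J₂ x → x < β → ⊥
      below-β x∈ x<β = noAlt-top top T⊆G μ∉T wsTμ J₂≤T (alt x∈ β∈ α∈′ x<β β<α)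
      -- Below q, the set J₁ ∖ J₂ contains only ε; above q nothing, since ε ∈ J₁ ∖ J₂ and q ∈ J₂ ∖ J₁.
      -- But J₁ is larger than J₂.
      finish : ∀ {q} → Diff J₂ T q → q ∉ J₁ → (∀ {x} → x < q → x < c) → (∀ {x} → x < q → x < β) → ⊥
      finish {q} q∈ q∉J₁ <q⇒<c <q⇒<β
        with balance (ℕ.s≤s⁻¹ (subst (∣ J₂ ∣ ℕ.<_) (∣⊖∣ ε∈J₁) (ℕ.≤-<-trans J₂≤T T<J₁)))
               (proj₁ q∈ , q∉J₁ ∘ ∈⊖⁻ {X = J₁})
      ... | x , x∈ , x∉J₂ with <-cmp x q
      ... | tri≈ _ refl _ = x∉J₂ (proj₁ q∈)
      ... | tri> _ _ q<x = ws-noAlt ws₁₂ (ℕ.≤-<-trans J₂≤T T<J₁)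
              (alt (ε∈J₁ , ε∉J₂) (proj₁ q∈ , q∉J₁) (∈⊖⁻ {X = J₁} x∈ , x∉J₂)
                (bot (J₂⊆G (proj₁ q∈)) λ { refl → ε∉J₂ (proj₁ q∈) }) q<x)
      ... | tri< x<q _ _ with x ∈? T
      ... | yes x∈T = below-β (x∈T , x∉J₂) (<q⇒<β x<q)
      ... | no x∉T = ⊖-≢ {X = J₁} x∈ (below-c c∉J₁ x′∈ c<x′ (∈⊖⁻ {X = J₁} x∈ , x∉T) (<q⇒<c x<q))
      -- The point q is the smaller of β and c. If c < β but c ∉ `J₂`, then c < β < α already
      -- alternates `T ⊕ c` around `J₂`.
      choose : Tri (β < c) (β ≡ c) (c < β) → ⊥
      choose (tri≈ _ refl _) = finish β∈ c∉J₁ (λ p → p) (λ p → p)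
      choose (tri< β<c _ _) = finish β∈
        (λ β∈J₁ → ε∉J₂ (subst (_∈ J₂) (below-c c∉J₁ x′∈ c<x′ (β∈J₁ , proj₂ β∈) β<c) β∈J₂))
        (λ p → <-trans p β<c) (λ p → p)
      choose (tri> _ _ c<β) with c ∈? J₂
      ... | yes c∈J₂ = finish (c∈J₂ , c∉T) c∉J₁ (λ p → p) (λ p → <-trans p c<β)
      ... | no c∉J₂ = ws-noAlt (subst (WS (T ⊕ c)) (⊖-absent ε∉J₂) wsc₂)
              (subst (∣ J₂ ∣ ℕ.<_) (sym (∣⊕∣ c∉T)) (s≤s J₂≤T))
              (alt (∈⊕ T c , c∉J₂) (β∈J₂ , ∉⊕ (proj₂ β∈) λ { refl → <-irrefl refl c<β })
                (∈⊕⁺ (proj₁ α∈′) , α∉) c<β β<α)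

quotient-within : ∀ {C : List (Subset m)} → (∀ {J} → J List.∈ C → J ⊆ G) →
  ∀ e {J} → J List.∈ map (_⊖ e) C → J ⊆ G ⊖ e
quotient-within within e J∈ with ∈-map⁻ (_⊖ e) J∈
... | _ , J₀∈C , refl = ⊖-⊆ (within J₀∈C)

quotient-pairwise : ∀ {C : List (Subset m)} → (∀ {J} → J List.∈ C → J ⊆ G) → Pairwise C →
  ∀ e → (∀ {I J} → I ⊆ G → J ⊆ G → WS I J → WS (I ⊖ e) (J ⊖ e)) → Pairwise (map (_⊖ e) C)
quotient-pairwise within pw e ⊖-ws I∈ J∈ with ∈-map⁻ (_⊖ e) I∈ | ∈-map⁻ (_⊖ e) J∈
... | _ , I₀∈C , refl | _ , J₀∈C , refl = ⊖-ws (within I₀∈C) (within J₀∈C) (pw I₀∈C J₀∈C)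

-- Only μ can lie in J ∖ X, but an alternation in either direction needs an element of J ∖ X below
-- one of X.
almost-full-ws : ∀ {μ : Fin m} → Top μ G → X ⊆ G → μ ∉ X → (∀ {x} → x ∈ G → x ≢ μ → x ∈ X) →
  J ⊆ G → WS X J
almost-full-ws {X = X} {J = J} {μ = μ} top X⊆G μ∉X full J⊆G = both-noAlt⇒ws
  (λ (_ , _ , _ , _ , (y∈ , y∉) , (z∈ , _) , _ , y<z) →
    y∉ (full (J⊆G y∈) (top-≢ top (X⊆G z∈) (λ { refl → μ∉X z∈ }) y<z)))
  (λ (_ , _ , _ , (x∈ , x∉) , (y∈ , _) , _ , x<y , _) →
    x∉ (full (J⊆G x∈) (top-≢ top (X⊆G y∈) (λ { refl → μ∉X y∈ }) x<y)))

Augmentation : Subset m → Fin m → List (Subset m) → Subset m → Set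
Augmentation G μ C T = ∃ λ c → c ∈ G × c ≢ μ × c ∉ T × (∀ {J} → J List.∈ C → WS (T ⊕ c) J)

-- Induction on a bound n for |G|. The family is only assumed pairwise separated, so the hypothesis
-- applies at once to `map (_⊖ ε) C`, and later to families of complements.
augment : ∀ n {G μ} → ∣ G ∣ ℕ.≤ n → μ ∈ G → Top μ G →
  (C : List (Subset m)) → (∀ {J} → J List.∈ C → J ⊆ G) → Pairwise C →
  ∀ {T e} → T List.∈ C → T ⊕ μ List.∈ C → μ ∉ T → e ∈ G → e ≢ μ → e ∉ T →
  Augmentation G μ C T
augment zero {G} G≤0 μ∈G _ _ _ _ _ _ _ _ _ _ =
  contradiction (ℕ.≤-trans (ℕ.≤-reflexive (sym (∣⊖∣ μ∈G))) G≤0) λ ()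
augment (suc n) {G} {μ} G≤ μ∈G top C C⊆G pw {T} {e} T∈C Tμ∈C μ∉T e∈G e≢μ e∉T
  with minimum (μ , μ∈G)
... | ε , ε∈G , bot with any? (λ x → (x ∈? (G ⊖ ε)) ×-dec (¬? (x ≟ μ) ×-dec ¬? (x ∈? T)))
-- T already contains all of G except ε and μ, so `T ⊕ ε` is G without μ.
... | no ∄ = ε , ε∈G , ε≢μ , subst (_∉ T) e≡ε e∉T , λ J∈C →
  almost-full-ws top (⊕-⊆ (C⊆G T∈C) ε∈G) (∉⊕ μ∉T (ε≢μ ∘ sym)) full (C⊆G J∈C)
  where
  ε≢μ : ε ≢ μ
  ε≢μ refl = <-asym (bot e∈G e≢μ) (top e∈G e≢μ)
  e≡ε : e ≡ ε
  e≡ε with e ≟ ε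
  ... | yes p = p
  ... | no e≢ε = contradiction (e , ∈⊖⁺ e∈G e≢ε , e≢μ , e∉T) ∄
  full : ∀ {x} → x ∈ G → x ≢ μ → x ∈ T ⊕ ε
  full {x} x∈G x≢μ with x ≟ ε | x ∈? T
  ... | yes refl | _ = ∈⊕ T ε
  ... | no _ | yes x∈T = ∈⊕⁺ x∈T
  ... | no x≢ε | no x∉T = contradiction (x , ∈⊖⁺ x∈G x≢ε , x≢μ , x∉T) ∄
... | yes (e′ , e′∈ , e′≢μ , e′∉T) = pick IH
  where
  ε≢μ : ε ≢ μ
  ε≢μ refl = <-asym (bot e∈G e≢μ) (top e∈G e≢μ)
  T⊆G = C⊆G T∈C
  IH : Augmentation (G ⊖ ε) μ (map (_⊖ ε) C) (T ⊖ ε)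
  IH = augment n (ℕ.s≤s⁻¹ (subst (ℕ._≤ suc n) (∣⊖∣ ε∈G) G≤)) (∈⊖⁺ μ∈G (ε≢μ ∘ sym))
    (λ x∈ → top (∈⊖⁻ {X = G} x∈)) (map (_⊖ ε) C)
    (quotient-within C⊆G ε) (quotient-pairwise C⊆G pw ε (⊖-bot-ws bot))
    (∈-map⁺ (_⊖ ε) T∈C)
    (subst (List._∈ map (_⊖ ε) C) ([]≔-commutes T μ ε (ε≢μ ∘ sym)) (∈-map⁺ (_⊖ ε) Tμ∈C))
    (μ∉T ∘ ∈⊖⁻ {X = T}) e′∈ e′≢μ (e′∉T ∘ ∈⊖⁻ {X = T})
  pick : Augmentation (G ⊖ ε) μ (map (_⊖ ε) C) (T ⊖ ε) → Augmentation G μ C T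
  pick (c , c∈ , c≢μ , c∉ , wsc) with ε ∈? T
  ... | yes ε∈T = c , c∈G , c≢μ , c∉T , ws
    where
    c≢ε = ⊖-≢ {X = G} c∈
    c∈G = ∈⊖⁻ {X = G} c∈
    c∉T : c ∉ T
    c∉T c∈T = c∉ (∈⊖⁺ c∈T c≢ε)
    ws : ∀ {J} → J List.∈ C → WS (T ⊕ c) J
    ws {J} J∈C with ε ∈? J
    ... | yes ε∈J = ⊖-ws⁻ (∈⊕⁺ ε∈T) ε∈J (subst (λ X → WS X (J ⊖ ε))
                      (sym ([]≔-commutes T c ε c≢ε)) (wsc (∈-map⁺ (_⊖ ε) J∈C)))
    ... | no ε∉J = ⊕-ws-bot∈ bot top T⊆G μ∉T c∈G c∉T c≢μ ε∈T (C⊆G J∈C) ε∉J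
                     (pw T∈C J∈C) (pw Tμ∈C J∈C) (subst (WS _) (⊖-absent ε∉J) (wsc (∈-map⁺ (_⊖ ε) J∈C)))
  ... | no ε∉T = decide (all-ws? (T ⊕ c) C) (all-ws? (T ⊕ ε) C)
    where
    c≢ε = ⊖-≢ {X = G} c∈
    c∈G = ∈⊖⁻ {X = G} c∈
    c∉T : c ∉ T
    c∉T c∈T = c∉ (∈⊖⁺ c∈T c≢ε)
    wsc′ : ∀ {J} → J List.∈ C → WS (T ⊕ c) (J ⊖ ε)
    wsc′ J∈C = subst (λ X → WS (X ⊕ c) _) (⊖-absent ε∉T) (wsc (∈-map⁺ (_⊖ ε) J∈C))
    decide : (∀ {J} → J List.∈ C → WS (T ⊕ c) J) ⊎ (∃ λ J → J List.∈ C × ¬ WS (T ⊕ c) J) →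
      (∀ {J} → J List.∈ C → WS (T ⊕ ε) J) ⊎ (∃ λ J → J List.∈ C × ¬ WS (T ⊕ ε) J) →
      Augmentation G μ C T
    decide (inj₁ ws) _ = c , c∈G , c≢μ , c∉T , ws
    decide _ (inj₁ ws) = ε , ε∈G , ε≢μ , ε∉T , ws
    decide (inj₂ (J₁ , J₁∈C , ¬ws₁)) (inj₂ (J₂ , J₂∈C , ¬ws₂)) =
      ⊥-elim (⊕-ws-bot∉ bot top T⊆G μ∉T c∈G c∉T c≢μ ε∉T (C⊆G J₂∈C)
        (pw T∈C J₁∈C) (pw T∈C J₂∈C) (pw Tμ∈C J₂∈C) (pw J₁∈C J₂∈C) (wsc′ J₁∈C) (wsc′ J₂∈C) ¬ws₁ ¬ws₂)

-- Doubled sets of every size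

-- An element y of J left of an element x of X would extend to the alternation y < x < μ of J around
-- X.
noAlt⇒◁-⊖ : Top μ G → X ⊆ G → μ ∉ X → μ ∈ J → NoAlt J X → X ◁ J ⊖ μ
noAlt⇒◁-⊖ {X = X} {J = J} top X⊆G μ∉X μ∈J n {x} {y} (x∈ , x∉) (y∈ , y∉) with <-cmp x y
... | tri< x<y _ _ = x<y
... | tri≈ _ refl _ = contradiction x∈ y∉
... | tri> _ _ y<x = ⊥-elim (n (alt (∈⊖⁻ {X = J} y∈ , y∉) (x∈ , λ x∈J → x∉ (∈⊖⁺ x∈J x≢μ))
    (μ∈J , μ∉X) y<x (top (X⊆G x∈) x≢μ)))
  where
  x≢μ : x ≢ _
  x≢μ refl = μ∉X x∈

noAlt⇒◁ : Top μ G → J ⊆ G → μ ∉ J → NoAlt (X ⊕ μ) J → J ◁ X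
noAlt⇒◁ {μ = μ} {J = J} {X = X} top J⊆G μ∉J n {x} {y} (x∈ , x∉) (y∈ , y∉) with <-cmp x y
... | tri< x<y _ _ = x<y
... | tri≈ _ refl _ = contradiction x∈ y∉
... | tri> _ _ y<x = ⊥-elim (n (alt (∈⊕⁺ y∈ , y∉) (x∈ , ∉⊕ x∉ x≢μ)
    (∈⊕ X μ , μ∉J) y<x (top (J⊆G x∈) x≢μ)))
  where
  x≢μ : x ≢ _
  x≢μ refl = μ∉J x∈

noAlt-⊖ : μ ∉ X → NoAlt X J → NoAlt X (J ⊖ μ)
noAlt-⊖ {μ = μ} {X = X} {J = J} μ∉X n (_ , _ , _ , p , (y∈ , y∉) , r , s , t) =
  n (alt (up p) (∈⊖⁻ {X = J} y∈ , y∉) (up r) s t)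
  where
  up : ∀ {x} → Diff X (J ⊖ μ) x → Diff X J x
  up (x∈ , x∉) = x∈ , λ x∈J → x∉ (∈⊖⁺ x∈J λ { refl → μ∉X x∈ })

module _ {G V U : Subset m} {ε μ : Fin m} (bot : Bot ε G) (top : Top μ G)
  (μ∈G : μ ∈ G)
  (V⊆G : V ⊆ G) (U⊆G : U ⊆ G) (ε∉V : ε ∉ V) (μ∉V : μ ∉ V) (μ∉U : μ ∉ U)
  (ε≢μ : ε ≢ μ) (∣U∣ : ∣ U ∣ ≡ suc ∣ V ∣) (V◁U : V ◁ U) where

  record Compatible (A : Subset m) : Set where
    field
      A⊆G : A ⊆ G
      V-A : WS V A
      Vμ-A : WS (V ⊕ μ) A
      U-A : WS U A
      Uμ-A : WS (U ⊕ μ) A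

  private
    pair : Pair⇒ U V
    pair = pair-balance (ℕ.≤-reflexive ∣U∣)

    V<U : ∣ V ∣ ℕ.< ∣ U ∣
    V<U = ℕ.≤-reflexive (sym ∣U∣)

    U<Uμ : ∣ U ∣ ℕ.< ∣ U ⊕ μ ∣
    U<Uμ = ℕ.≤-reflexive (sym (∣⊕∣ μ∉U))

    V<Vμ : ∣ V ∣ ℕ.< ∣ V ⊕ μ ∣
    V<Vμ = ℕ.≤-reflexive (sym (∣⊕∣ μ∉V))

  -- For A = J₁ ∖ ε and B = J₂, where J₁ obstructs U and J₂ obstructs V ∪ ε: size by size, V is left
  -- of U, U has to be left of A, A is left of B, and B has to be left of V.
  incompatible : ∀ {A B} → Compatible A → Compatible B → A ◁ B → ∣ U ∣ ℕ.≤ ∣ A ∣ → ∣ B ∣ ℕ.≤ ∣ U ∣ →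
    ∀ {y z j w} → Diff U A y → Diff A U z → y < z → Diff B V j → Diff (V ⊕ μ) B w → j < w → ⊥
  incompatible {A} {B} compA compB A◁B U≤A B≤U {y} {z} {j} {w} y∈ z∈ y<z j∈ w∈ j<w = main (μ ∈? A) (μ ∈? B)
    where
    open Compatible compA
    open Compatible compB using () renaming (A⊆G to B⊆G; V-A to V-B; Vμ-A to Vμ-B; U-A to U-B; Uμ-A to Uμ-B)

    V<A : ∣ V ∣ ℕ.< ∣ A ∣
    V<A = ℕ.<-≤-trans V<U U≤A

    A-V : NoAlt A V
    A-V = ws-noAlt (ws-sym V-A) V<A

    Uμ-B′ : NoAlt (U ⊕ μ) B
    Uμ-B′ = ws-noAlt Uμ-B (ℕ.≤-<-trans B≤U U<Uμ)

    -- Otherwise `U ⊕ μ` is larger than A and alternates around it as y < z < μ.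
    U<A : μ ∉ A → ∣ U ∣ ℕ.< ∣ A ∣
    U<A μ∉A = ℕ.≰⇒> λ A≤U → ws-noAlt Uμ-A (ℕ.≤-<-trans A≤U U<Uμ)
      (alt (∈⊕⁺ (proj₁ y∈) , proj₂ y∈) (proj₁ z∈ , ∉⊕ (proj₂ z∈) z≢μ) (∈⊕ U μ , μ∉A)
        y<z (top (A⊆G (proj₁ z∈)) z≢μ))
      where
      z≢μ : z ≢ μ
      z≢μ refl = μ∉A (proj₁ z∈)

    A-U : μ ∉ A → NoAlt A U
    A-U μ∉A = ws-noAlt (ws-sym U-A) (U<A μ∉A)

    V◁A₀ : μ ∈ A → V ◁ A ⊖ μ
    V◁A₀ μ∈A = noAlt⇒◁-⊖ top V⊆G μ∉V μ∈A A-V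

    B◁U : μ ∉ B → B ◁ U
    B◁U μ∉B = noAlt⇒◁ top B⊆G μ∉B Uμ-B′

    B◁V : μ ∉ B → ∣ B ∣ ℕ.≤ ∣ V ∣ → B ◁ V
    B◁V μ∉B B≤V = noAlt⇒◁ top B⊆G μ∉B (ws-noAlt Vμ-B (ℕ.≤-<-trans B≤V V<Vμ))

    -- The greatest element lies in A ∖ B, so `A ◁ B` leaves nothing in B ∖ A.
    B⊆A₀ : μ ∈ A → μ ∉ B → ∀ {x} → ¬ Diff B (A ⊖ μ) x
    B⊆A₀ μ∈A μ∉B (x∈ , x∉) =
      <-asym (A◁B (μ∈A , μ∉B) (x∈ , λ x∈A → x∉ (∈⊖⁺ x∈A x≢μ))) (top (B⊆G x∈) x≢μ)
      where
      x≢μ : _ ≢ μ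
      x≢μ refl = μ∉B x∈

    y∈₀ : Diff U (A ⊖ μ) y
    y∈₀ = proj₁ y∈ , proj₂ y∈ ∘ ∈⊖⁻ {X = A}

    module _ (μ∈B : μ ∈ B) where
      w∈₀ : Diff V (B ⊖ μ) w
      w∈₀ = update⁻ (λ { refl → proj₂ w∈ μ∈B }) (proj₁ w∈) , proj₂ w∈ ∘ ∈⊖⁻ {X = B}
      w<μ : w < μ
      w<μ = top (V⊆G (proj₁ w∈₀)) λ { refl → μ∉V (proj₁ w∈₀) }
      j∈₀ : Diff (B ⊖ μ) V j
      j∈₀ = ∈⊖⁺ (proj₁ j∈) (λ { refl → <-asym j<w w<μ }) , proj₂ j∈
      B≤V×V-B : ∣ B ∣ ℕ.≤ ∣ V ∣ × NoAlt V B
      B≤V×V-B = [ (λ p → p) , (λ (_ , n) → ⊥-elim (n (alt j∈ (proj₁ w∈₀ , proj₂ w∈) (μ∈B , μ∉V) j<w w<μ))) ]′ V-B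
      V-B₀ : NoAlt V (B ⊖ μ)
      V-B₀ = noAlt-⊖ μ∉V (proj₂ B≤V×V-B)
      U-B₀ : NoAlt U (B ⊖ μ)
      U-B₀ = noAlt-⊖ μ∉U (noAlt-top top U⊆G μ∉U Uμ-B B≤U)
      B₀<V : ∣ B ⊖ μ ∣ ℕ.< ∣ V ∣
      B₀<V = subst (ℕ._≤ ∣ V ∣) (∣⊖∣ μ∈B) (proj₁ B≤V×V-B)

    A₀◁B₀ : A ⊖ μ ◁ B ⊖ μ
    A₀◁B₀ p q = A◁B (proj₁ (⊖-diff p)) (proj₁ (⊖-diff q))

    -- `μ ∈ A` gives `V ◁ A ⊖ μ`, and `μ ∉ B` gives `B ◁ U`. With both, the `◁` clashes or the sizes
    -- alone finish; with only the first, the surround clashes apply directly; with only the second,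
    -- they apply dually; with neither, `double-clash` applies.
    main : Dec (μ ∈ A) → Dec (μ ∈ B) → ⊥
    main (no μ∉A) (no μ∉B) with ∣ B ∣ ℕ.≤? ∣ V ∣
    ... | yes B≤V = Dual.surround-clash₂ (B◁U μ∉B) (A-U μ∉A) A◁B y∈ z∈ y<z
                      (excess (ℕ.≤-<-trans B≤U (U<A μ∉A)))
                      (B◁V μ∉B B≤V) V◁U A-V pair j∈
    ... | no B≰V = Dual.surround-clash₁ (B◁U μ∉B) (A-U μ∉A) A◁B y∈ z∈ y<z
                      (excess (ℕ.≤-<-trans B≤U (U<A μ∉A)))
                      (balance (subst (ℕ._≤ ∣ B ∣) (sym ∣U∣) (ℕ.≰⇒> B≰V)))
    main (yes μ∈A) (no μ∉B) with ∣ B ∣ ℕ.≤? ∣ V ∣ | ∣ A ∣ ℕ.≤? ∣ U ∣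
    ... | yes B≤V | yes A≤U = Dual.◁-clash₂ (B◁V μ∉B B≤V) (V◁A₀ μ∈A) (B⊆A₀ μ∈A μ∉B)
                      (balance (ℕ.s≤s⁻¹ (subst₂ ℕ._≤_ (∣⊖∣ μ∈A) ∣U∣ A≤U))) j∈
    ... | no B≰V | yes A≤U = B⊆A₀ μ∈A μ∉B (proj₂ (excess
                      (subst (ℕ._≤ ∣ B ∣) (∣⊖∣ μ∈A) (ℕ.≤-trans A≤U (subst (ℕ._≤ ∣ B ∣) (sym ∣U∣) (ℕ.≰⇒> B≰V))))))
    ... | yes B≤V | no A≰U = Direct.◁-clash₁ V◁U (V◁A₀ μ∈A)
                      (noAlt⇒◁-⊖ top U⊆G μ∉U μ∈A (ws-noAlt (ws-sym U-A) (ℕ.≰⇒> A≰U)))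
                      (B◁V μ∉B B≤V) (B◁U μ∉B) (B⊆A₀ μ∈A μ∉B) pair j∈ y∈₀
    ... | no B≰V | no A≰U = Direct.◁-clash₂
                      (noAlt⇒◁-⊖ top U⊆G μ∉U μ∈A (ws-noAlt (ws-sym U-A) (ℕ.≰⇒> A≰U)))
                      (B◁U μ∉B) (B⊆A₀ μ∈A μ∉B) (balance (subst (ℕ._≤ ∣ B ∣) (sym ∣U∣) (ℕ.≰⇒> B≰V))) y∈₀
    main (yes μ∈A) (yes μ∈B) with ∣ A ∣ ℕ.≤? ∣ U ∣
    ... | yes A≤U = Direct.surround-clash₁ (V◁A₀ μ∈A) (V-B₀ μ∈B) A₀◁B₀ (j∈₀ μ∈B) (w∈₀ μ∈B) j<w
                      (excess (ℕ.<-≤-trans (B₀<V μ∈B) (ℕ.s≤s⁻¹ (subst (suc ∣ V ∣ ℕ.≤_) (∣⊖∣ μ∈A) V<A))))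
                      (balance (ℕ.s≤s⁻¹ (subst₂ ℕ._≤_ (∣⊖∣ μ∈A) ∣U∣ A≤U)))
    ... | no A≰U = Direct.surround-clash₂ (V◁A₀ μ∈A) (V-B₀ μ∈B) A₀◁B₀ (j∈₀ μ∈B) (w∈₀ μ∈B) j<w
                      (excess (ℕ.<-≤-trans (B₀<V μ∈B) (ℕ.s≤s⁻¹ (subst (suc ∣ V ∣ ℕ.≤_) (∣⊖∣ μ∈A) V<A))))
                      (noAlt⇒◁-⊖ top U⊆G μ∉U μ∈A (ws-noAlt (ws-sym U-A) (ℕ.≰⇒> A≰U)))
                      V◁U (U-B₀ μ∈B) pair y∈₀
    main (no μ∉A) (yes μ∈B) = Direct.double-clash V◁U A◁B₀ (A-U μ∉A) A-V (V-B₀ μ∈B) (U-B₀ μ∈B) pair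
                      y∈ z∈ y<z (j∈₀ μ∈B) (w∈₀ μ∈B) j<w
                      (excess (ℕ.<-trans (B₀<V μ∈B) V<A))
                      (Dual.double-clash-outside V◁U A◁B₀ (V-B₀ μ∈B) (U-B₀ μ∈B)
                        (A-U μ∉A) A-V pair (j∈₀ μ∈B) (w∈₀ μ∈B) j<w y∈ z∈ y<z)
      where
      A◁B₀ : A ◁ B ⊖ μ
      A◁B₀ (x∈ , x∉) (y∈ , y∉) =
        A◁B (x∈ , λ x∈B → x∉ (∈⊖⁺ x∈B λ { refl → μ∉A x∈ })) (∈⊖⁻ {X = B} y∈ , y∉)

  -- By `bot-block∈` the obstruction contains ε; the last two points of its alternation differ from
  -- ε and survive the deletion.
  block-U : J ⊆ G → WS U (J ⊖ ε) → WS (U ⊕ μ) (J ⊖ ε) → ¬ WS U J ⊎ ¬ WS (U ⊕ μ) J →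
    ε ∈ J × ∣ U ∣ ℕ.< ∣ J ∣ × ∃ λ y → ∃ λ z → Diff U (J ⊖ ε) y × Diff (J ⊖ ε) U z × y < z
  block-U {J = J} J⊆G wsU wsUμ (inj₁ ¬ws) with bot-block∈ bot U⊆G wsU ¬ws
  ... | ε∈J , U<J with ¬NoAlt⇒Alt J U (λ n → ¬ws (inj₂ (ℕ.<⇒≤ U<J , n)))
  ... | _ , y , z , (x∈ , _) , (y∈ , y∉) , (z∈ , z∉) , x<y , y<z =
    ε∈J , U<J , y , z , (y∈ , y∉ ∘ ∈⊖⁻ {X = J}) , (∈⊖⁺ z∈ (bot-≢ bot (U⊆G y∈) y<z) , z∉) , y<z
  block-U {J = J} J⊆G wsU wsUμ (inj₂ ¬ws) with bot-block∈ bot (⊕-⊆ U⊆G μ∈G) wsUμ ¬ws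
  ... | ε∈J , Uμ<J with ¬NoAlt⇒Alt J (U ⊕ μ) (λ n → ¬ws (inj₂ (ℕ.<⇒≤ Uμ<J , n)))
  ... | _ , y , z , (x∈ , _) , (y∈ , y∉) , (z∈ , z∉) , x<y , y<z =
    ε∈J , ℕ.<-trans U<Uμ Uμ<J , y , z , (y∈U , y∉ ∘ ∈⊖⁻ {X = J}) ,
      (∈⊖⁺ z∈ (bot-≢ bot (U⊆G y∈U) y<z) , ∉⊕⁻ z∉) , y<z
    where
    y∈U : y ∈ U
    y∈U = update⁻ (top-≢ top (J⊆G z∈) (λ { refl → z∉ (∈⊕ U μ) }) y<z) y∈

  -- By `bot-block∉` the obstruction omits ε. Only the first point of the alternation around it can
  -- be ε, so the last two are kept as witnesses.
  block-V : J ⊆ G → WS V (J ⊖ ε) → WS (V ⊕ μ) (J ⊖ ε) → ¬ WS (V ⊕ ε) J ⊎ ¬ WS ((V ⊕ μ) ⊕ ε) J →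
    ε ∉ J × ∣ J ∣ ℕ.≤ ∣ U ∣ × ∃ λ j → ∃ λ w → Diff J V j × Diff (V ⊕ μ) J w × j < w
  block-V {J = J} J⊆G wsV wsVμ (inj₁ ¬ws) with bot-block∉ bot J⊆G ε∉V wsV ¬ws
  ... | ε∉J , J≤V with ¬NoAlt⇒Alt (V ⊕ ε) J
          (λ n → ¬ws (inj₁ (subst (∣ J ∣ ℕ.≤_) (sym (∣⊕∣ ε∉V)) (ℕ.m≤n⇒m≤1+n J≤V) , n)))
  ... | _ , j , w , _ , (j∈ , j∉) , (w∈ , w∉) , _ , j<w =
    ε∉J , ℕ.≤-trans J≤V (ℕ.<⇒≤ V<U) , j , w , (j∈ , ∉⊕⁻ j∉) ,
      (∈⊕⁺ (update⁻ (bot-≢ bot (J⊆G j∈) j<w) w∈) , w∉) , j<w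
  block-V {J = J} J⊆G wsV wsVμ (inj₂ ¬ws) with bot-block∉ bot J⊆G (∉⊕ ε∉V ε≢μ) wsVμ ¬ws
  ... | ε∉J , J≤Vμ with ¬NoAlt⇒Alt ((V ⊕ μ) ⊕ ε) J
          (λ n → ¬ws (inj₁ (subst (∣ J ∣ ℕ.≤_) (sym (∣⊕∣ (∉⊕ ε∉V ε≢μ))) (ℕ.m≤n⇒m≤1+n J≤Vμ) , n)))
  ... | _ , j , w , _ , (j∈ , j∉) , (w∈ , w∉) , _ , j<w =
    ε∉J , subst (∣ J ∣ ℕ.≤_) (trans (∣⊕∣ μ∉V) (sym ∣U∣)) J≤Vμ , j , w , (j∈ , ∉⊕⁻ (∉⊕⁻ j∉)) ,
      (update⁻ (bot-≢ bot (J⊆G j∈) j<w) w∈ , w∉) , j<w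

  no-double-block : ∀ {J₁ J₂} → J₁ ⊆ G → J₂ ⊆ G → WS J₁ J₂ → Compatible (J₁ ⊖ ε) → Compatible (J₂ ⊖ ε) →
    ¬ WS U J₁ ⊎ ¬ WS (U ⊕ μ) J₁ → ¬ WS (V ⊕ ε) J₂ ⊎ ¬ WS ((V ⊕ μ) ⊕ ε) J₂ → ⊥
  no-double-block {J₁} {J₂} J₁⊆G J₂⊆G ws comp₁ comp₂ block₁ block₂
    with block-U J₁⊆G (Compatible.U-A comp₁) (Compatible.Uμ-A comp₁) block₁
       | block-V J₂⊆G (Compatible.V-A comp₂) (Compatible.Vμ-A comp₂) block₂
  ... | ε∈J₁ , U<J₁ , _ , _ , y∈ , z∈ , y<z | ε∉J₂ , J₂≤U , _ , _ , j∈ , w∈ , j<w =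
    incompatible comp₁ (subst Compatible (⊖-absent ε∉J₂) comp₂) A◁B
      (ℕ.s≤s⁻¹ (subst (∣ U ∣ ℕ.<_) (∣⊖∣ ε∈J₁) U<J₁)) J₂≤U y∈ z∈ y<z j∈ w∈ j<w
    where
    -- `J₁` is larger than `J₂` and ε lies in `J₁` only, so a pair q < x in the wrong order would
    -- alternate as ε < q < x.
    A◁B : J₁ ⊖ ε ◁ J₂
    A◁B {x} {q} (x∈ , x∉) (q∈ , q∉) with <-cmp x q
    ... | tri< x<q _ _ = x<q
    ... | tri≈ _ refl _ = contradiction x∈ q∉
    ... | tri> _ _ q<x = ⊥-elim (ws-noAlt ws (ℕ.≤-<-trans J₂≤U U<J₁)
            (alt (ε∈J₁ , ε∉J₂) (q∈ , λ q∈J₁ → q∉ (∈⊖⁺ q∈J₁ q≢ε)) (∈⊖⁻ {X = J₁} x∈ , x∉)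
              (bot (J₂⊆G q∈) q≢ε) q<x))
      where
      q≢ε : q ≢ ε
      q≢ε refl = ε∉J₂ q∈

-- Repetitions in C are allowed, so that the list `map (_⊖ μ) C` can itself be maximal.
record Maximal (G : Subset m) (C : List (Subset m)) : Set where
  field
    within : ∀ {J} → J List.∈ C → J ⊆ G
    pairwise : Pairwise C
    closed : ∀ {Z} → Z ⊆ G → (∀ {J} → J List.∈ C → WS Z J) → Z List.∈ C

⊆-ws : I ⊆ J → WS I J
⊆-ws I⊆J = ◁⇒ws λ (x∈I , x∉J) _ → contradiction (I⊆J x∈I) x∉J

allSubsets : ∀ m → List (Subset m)
allSubsets zero = [] ∷ []
allSubsets (suc m) = map (inside ∷_) (allSubsets m) ++ map (outside ∷_) (allSubsets m)

∈-allSubsets : ∀ {m} (X : Subset m) → X List.∈ allSubsets m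
∈-allSubsets [] = here refl
∈-allSubsets (inside ∷ X) = ∈-++⁺ˡ (∈-map⁺ _ (∈-allSubsets X))
∈-allSubsets (outside ∷ X) = ∈-++⁺ʳ _ (∈-map⁺ _ (∈-allSubsets X))

-- Greedy: the candidates in `Xs` are tried in turn. A candidate inside G is rejected only because
-- of a member that stays, so the final family still rejects it.
complete : ∀ (Xs : List (Subset m)) {G} C → (∀ {J} → J List.∈ C → J ⊆ G) → Pairwise C →
  ∃ λ D → (∀ {J} → J List.∈ C → J List.∈ D) × (∀ {J} → J List.∈ D → J ⊆ G) × Pairwise D ×
    (∀ {Z} → Z List.∈ Xs → Z ⊆ G → (∀ {J} → J List.∈ D → WS Z J) → Z List.∈ D)
complete [] C within pw = C , (λ p → p) , (λ p → within p) , pw , λ ()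
complete (X ∷ Xs) {G} C within pw with X ⊆? G | all-ws? X C
... | yes X⊆G | inj₁ ws with complete Xs {G} (X ∷ C)
      (λ { (here refl) → X⊆G ; (there J∈) → within J∈ })
      (λ { (here refl) (here refl) → ⊆-ws (λ p → p)
         ; (here refl) (there J∈) → ws J∈
         ; (there I∈) (here refl) → ws-sym (ws I∈)
         ; (there I∈) (there J∈) → pw I∈ J∈ })
... | D , C⊆D , within′ , pw′ , closed = D , C⊆D ∘ there , (λ p → within′ p) , pw′ ,
  λ { (here refl) _ _ → C⊆D (here refl) ; (there Z∈) → closed Z∈ }
complete (X ∷ Xs) {G} C within pw | no X⊈G | _ with complete Xs {G} C within pw
... | D , C⊆D , within′ , pw′ , closed = D , C⊆D , (λ p → within′ p) , pw′ ,
  λ { (here refl) X⊆G _ → contradiction (λ {x} → X⊆G {x}) X⊈G ; (there Z∈) → closed Z∈ }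
complete (X ∷ Xs) {G} C within pw | yes _ | inj₂ (J , J∈C , ¬ws) with complete Xs {G} C within pw
... | D , C⊆D , within′ , pw′ , closed = D , C⊆D , (λ p → within′ p) , pw′ ,
  λ { (here refl) _ ws → contradiction (ws (C⊆D J∈C)) ¬ws ; (there Z∈) → closed Z∈ }

completion : ∀ {G : Subset m} C → (∀ {J} → J List.∈ C → J ⊆ G) → Pairwise C →
  ∃ λ D → (∀ {J} → J List.∈ C → J List.∈ D) × Maximal G D
completion {m} C within pw with complete (allSubsets m) C within pw
... | D , C⊆D , within′ , pw′ , closed = D , C⊆D , record
  { within = within′ ; pairwise = pw′ ; closed = λ Z⊆G → closed (∈-allSubsets _) Z⊆G }

Doubled : Fin m → List (Subset m) → ℕ → Set
Doubled μ C i = ∃ λ T → ∣ T ∣ ≡ i × μ ∉ T × T List.∈ C × T ⊕ μ List.∈ C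

doubled : ∀ n {G : Subset m} {μ C} → ∣ G ∣ ℕ.≤ n → Maximal G C → μ ∈ G → Top μ G →
  ∀ i → i ℕ.< ∣ G ∣ → Doubled μ C i
doubled zero G≤0 _ _ _ i i<G = contradiction (ℕ.<-≤-trans i<G G≤0) λ ()
doubled {m} (suc n) {G} {μ} G≤ max μ∈G top zero _ = Subset.⊥ , ∣⊥∣≡0 m , ∉⊥ ,
  closed (λ x∈ → ⊥-elim (∉⊥ x∈)) (λ _ → ⊆-ws (λ x∈ → ⊥-elim (∉⊥ x∈))) ,
  closed (⊕-⊆ (λ x∈ → ⊥-elim (∉⊥ x∈)) μ∈G) (λ J∈C → ws-sym (◁⇒ws (last J∈C)))
  where
  open Maximal max
  last : ∀ {J} → J List.∈ _ → J ◁ Subset.⊥ ⊕ μ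
  last J∈C (x∈ , x∉) (y∈ , _) with ∈⊕⁻ y∈
  ... | inj₂ y∈⊥ = ⊥-elim (∉⊥ y∈⊥)
  ... | inj₁ refl = top (within J∈C x∈) λ { refl → x∉ y∈ }
doubled (suc n) {G} {μ} {C} G≤ max μ∈G top (suc i) i<G with suc (suc i) ℕ.≟ ∣ G ∣
-- In the largest size the doubled set is G without μ; both it and G are separated from every subset
-- of G.
... | yes eq = G ⊖ μ , ℕ.suc-injective (trans (sym (∣⊖∣ μ∈G)) (sym eq)) , ∉⊖ G μ ,
  closed (∈⊖⁻ {X = G}) (λ J∈C → almost-full-ws top (∈⊖⁻ {X = G}) (∉⊖ G μ) ∈⊖⁺ (within J∈C)) ,
  subst (List._∈ C) (sym (⊖⊕ μ∈G)) (closed (λ p → p) (λ J∈C → ws-sym (⊆-ws (within J∈C))))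
  where open Maximal max
... | no neq with minimum (μ , μ∈G)
... | ε , ε∈G , bot = choose
  where
  open Maximal max
  1+i<G⊖ : ∀ {e} → e ∈ G → suc i ℕ.< ∣ G ⊖ e ∣
  1+i<G⊖ e∈G = ℕ.s≤s⁻¹ (subst (suc (suc i) ℕ.<_) (∣⊖∣ e∈G) (ℕ.≤∧≢⇒< i<G neq))
  ε≢μ : ε ≢ μ
  ε≢μ refl with nonempty {G = G ⊖ μ} (ℕ.<-trans (s≤s z≤n) (1+i<G⊖ μ∈G))
  ... | e , e∈ = <-asym (bot (∈⊖⁻ {X = G} e∈) (⊖-≢ {X = G} e∈)) (top (∈⊖⁻ {X = G} e∈) (⊖-≢ {X = G} e∈))

  C′ = map (_⊖ ε) C
  -- The image of C is not yet known to be maximal, so it is completed. Since D contains every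
  -- `J ⊖ ε` with J in C, doubled sets of D are separated from all of these.
  D,max = completion C′ (quotient-within within ε) (quotient-pairwise within pairwise ε (⊖-bot-ws bot))
  D = proj₁ D,max
  C′⊆D = proj₁ (proj₂ D,max)
  D-max = proj₂ (proj₂ D,max)
  module D = Maximal D-max
  G′≤n : ∣ G ⊖ ε ∣ ℕ.≤ n
  G′≤n = ℕ.s≤s⁻¹ (subst (ℕ._≤ suc n) (∣⊖∣ ε∈G) G≤)
  top′ : Top μ (G ⊖ ε)
  top′ x∈ = top (∈⊖⁻ {X = G} x∈)
  level : ∀ k → k ℕ.< ∣ G ⊖ ε ∣ → Doubled μ D k
  level = doubled n G′≤n D-max (∈⊖⁺ μ∈G (ε≢μ ∘ sym)) top′

  from : Doubled μ D i → Doubled μ D (suc i) → Doubled μ C (suc i)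
  from (V , ∣V∣ , μ∉V , V∈D , Vμ∈D) (U , ∣U∣ , μ∉U , U∈D , Uμ∈D) =
    -- Unobstructed U and `U ⊕ μ` make U doubled in C. Otherwise `clash` excludes any obstruction to
    -- `V ⊕ ε` and `(V ⊕ μ) ⊕ ε`, and `V ⊕ ε` is doubled.
    decide (all-ws? U C) (all-ws? (U ⊕ μ) C) (all-ws? (V ⊕ ε) C) (all-ws? ((V ⊕ μ) ⊕ ε) C)
    where
    V⊆G : V ⊆ G
    V⊆G = ∈⊖⁻ {X = G} ∘ D.within V∈D
    U⊆G : U ⊆ G
    U⊆G = ∈⊖⁻ {X = G} ∘ D.within U∈D
    ε∉V : ε ∉ V
    ε∉V = ∉⊖ G ε ∘ D.within V∈D
    ∣U∣≡ : ∣ U ∣ ≡ suc ∣ V ∣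
    ∣U∣≡ = trans ∣U∣ (cong suc (sym ∣V∣))
    V◁U : V ◁ U
    V◁U = noAlt⇒◁ top V⊆G μ∉V (ws-noAlt (D.pairwise Uμ∈D V∈D)
      (subst₂ ℕ._<_ (sym ∣V∣) (sym (trans (∣⊕∣ μ∉U) (cong suc ∣U∣))) (ℕ.m≤n⇒m≤1+n (ℕ.n<1+n i))))
    compatible : ∀ {J} → J List.∈ C →
      Compatible bot top μ∈G V⊆G U⊆G ε∉V μ∉V μ∉U ε≢μ ∣U∣≡ V◁U (J ⊖ ε)
    compatible {J} J∈C = record
      { A⊆G = within J∈C ∘ ∈⊖⁻ {X = J}
      ; V-A = D.pairwise V∈D J∈D ; Vμ-A = D.pairwise Vμ∈D J∈D
      ; U-A = D.pairwise U∈D J∈D ; Uμ-A = D.pairwise Uμ∈D J∈D }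
      where J∈D = C′⊆D (∈-map⁺ (_⊖ ε) J∈C)
    clash : (∃ λ J → J List.∈ C × (¬ WS U J ⊎ ¬ WS (U ⊕ μ) J)) →
      (∃ λ J → J List.∈ C × (¬ WS (V ⊕ ε) J ⊎ ¬ WS ((V ⊕ μ) ⊕ ε) J)) → ⊥
    clash (J₁ , J₁∈C , block₁) (J₂ , J₂∈C , block₂) =
      no-double-block bot top μ∈G V⊆G U⊆G ε∉V μ∉V μ∉U ε≢μ ∣U∣≡ V◁U
        (within J₁∈C) (within J₂∈C) (pairwise J₁∈C J₂∈C) (compatible J₁∈C) (compatible J₂∈C) block₁ block₂
    Verdict : Subset _ → Set
    Verdict X = (∀ {J} → J List.∈ C → WS X J) ⊎ ∃ λ J → J List.∈ C × ¬ WS X J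
    decideV : (∃ λ J → J List.∈ C × (¬ WS U J ⊎ ¬ WS (U ⊕ μ) J)) →
      Verdict (V ⊕ ε) → Verdict ((V ⊕ μ) ⊕ ε) → Doubled μ C (suc i)
    decideV b (inj₁ ws) (inj₁ wsμ) = V ⊕ ε , trans (∣⊕∣ ε∉V) (cong suc ∣V∣) , ∉⊕ μ∉V (ε≢μ ∘ sym) ,
      closed (⊕-⊆ V⊆G ε∈G) ws ,
      subst (List._∈ C) ([]≔-commutes V μ ε (ε≢μ ∘ sym)) (closed (⊕-⊆ (⊕-⊆ V⊆G μ∈G) ε∈G) wsμ)
    decideV b (inj₂ (J , J∈C , ¬ws)) _ = ⊥-elim (clash b (J , J∈C , inj₁ ¬ws))
    decideV b _ (inj₂ (J , J∈C , ¬ws)) = ⊥-elim (clash b (J , J∈C , inj₂ ¬ws))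
    decide : Verdict U → Verdict (U ⊕ μ) → Verdict (V ⊕ ε) → Verdict ((V ⊕ μ) ⊕ ε) → Doubled μ C (suc i)
    decide (inj₁ ws) (inj₁ wsμ) _ _ = U , ∣U∣ , μ∉U , closed U⊆G ws , closed (⊕-⊆ U⊆G μ∈G) wsμ
    decide (inj₂ (J , J∈C , ¬ws)) _ = decideV (J , J∈C , inj₁ ¬ws)
    decide _ (inj₂ (J , J∈C , ¬ws)) = decideV (J , J∈C , inj₂ ¬ws)

  choose : Doubled μ C (suc i)
  choose = from (level i (ℕ.<-trans (ℕ.n<1+n i) (1+i<G⊖ ε∈G))) (level (suc i) (1+i<G⊖ ε∈G))

-- Maximality of the quotient

∈─⁻ : ∀ {m} {X Y : Subset m} {x} → x ∈ X ─ Y → x ∉ Y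
∈─⁻ {X = _ ∷ X} {inside ∷ Y} {zero} ()
∈─⁻ {X = _ ∷ X} {outside ∷ Y} {zero} _ ()
∈─⁻ {X = _ ∷ X} {_ ∷ Y} {suc x} (there x∈) (there x∈Y) = ∈─⁻ x∈ x∈Y

∣─∣ : ∀ {m} {G X : Subset m} → X ⊆ G → ∣ G ─ X ∣ + ∣ X ∣ ≡ ∣ G ∣
∣─∣ {G = []} {[]} _ = refl
∣─∣ {G = outside ∷ G} {inside ∷ X} X⊆G with () ← X⊆G here
∣─∣ {G = inside ∷ G} {inside ∷ X} X⊆G = trans (ℕ.+-suc ∣ G ─ X ∣ ∣ X ∣) (cong suc (∣─∣ (drop-∷-⊆ X⊆G)))
∣─∣ {G = inside ∷ G} {outside ∷ X} X⊆G = cong suc (∣─∣ (drop-∷-⊆ X⊆G))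
∣─∣ {G = outside ∷ G} {outside ∷ X} X⊆G = ∣─∣ (drop-∷-⊆ X⊆G)

─-involutive : X ⊆ G → G ─ (G ─ X) ≡ X
─-involutive {X = X} {G = G} X⊆G = ⊆-antisym to
  (λ x∈ → x∈p∧x∉q⇒x∈p─q (X⊆G x∈) λ x∈′ → ∈─⁻ {X = G} x∈′ x∈)
  where
  to : G ─ (G ─ X) ⊆ X
  to {x} x∈ with x ∈? X
  ... | yes x∈X = x∈X
  ... | no x∉X = contradiction (x∈p∧x∉q⇒x∈p─q (p─q⊆p G (G ─ X) x∈) x∉X) (∈─⁻ {X = G} x∈)

-- Complementation reverses the sizes and exchanges the two set differences, so the two alternatives
-- of `WS` change places.
─-ws : X ⊆ G → Y ⊆ G → WS X Y → WS (G ─ X) (G ─ Y)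
─-ws {G = G} X⊆G Y⊆G =
  [ (λ (p , n) → inj₂ (size X⊆G Y⊆G p , noAlt n))
  , (λ (p , n) → inj₁ (size Y⊆G X⊆G p , noAlt n)) ]′
  where
  size : ∀ {X Y} → X ⊆ G → Y ⊆ G → ∣ Y ∣ ℕ.≤ ∣ X ∣ → ∣ G ─ X ∣ ℕ.≤ ∣ G ─ Y ∣
  size {X} {Y} X⊆G Y⊆G Y≤X = ℕ.+-cancelʳ-≤ ∣ Y ∣ _ _ (ℕ.≤-trans (ℕ.+-monoʳ-≤ ∣ G ─ X ∣ Y≤X)
    (ℕ.≤-reflexive (trans (∣─∣ X⊆G) (sym (∣─∣ Y⊆G)))))
  diff : ∀ {X Y x} → Diff (G ─ X) (G ─ Y) x → Diff Y X x
  diff {X} {Y} {x} (x∈ , x∉) with x ∈? Y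
  ... | yes x∈Y = x∈Y , ∈─⁻ {X = G} x∈
  ... | no x∉Y = contradiction (x∈p∧x∉q⇒x∈p─q (p─q⊆p G X x∈) x∉Y) x∉
  noAlt : ∀ {X Y} → NoAlt Y X → NoAlt (G ─ X) (G ─ Y)
  noAlt n (_ , _ , _ , p , q , r , s , t) = n (alt (diff p) (diff q) (diff r) s t)

module _ {G : Subset m} {C : List (Subset m)} {μ : Fin m}
  (max : Maximal G C) (μ∈G : μ ∈ G) (top : Top μ G) where

  open Maximal max

  enlarge : ∀ {T e} → T List.∈ C → T ⊕ μ List.∈ C → μ ∉ T → e ∈ G → e ≢ μ → e ∉ T →
    ∃ λ c → c ∉ T × c ≢ μ × T ⊕ c List.∈ C
  enlarge T∈C Tμ∈C μ∉T e∈G e≢μ e∉T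
    with augment ∣ G ∣ ℕ.≤-refl μ∈G top C within pairwise T∈C Tμ∈C μ∉T e∈G e≢μ e∉T
  ... | c , c∈G , c≢μ , c∉T , ws = c , c∉T , c≢μ , closed (⊕-⊆ (within T∈C) c∈G) ws

  -- In the family of complements `G ─ (T ⊕ μ)` is doubled, and adding c to it amounts to removing c
  -- from `T ⊕ μ`.
  shrink : ∀ {T e} → T List.∈ C → T ⊕ μ List.∈ C → μ ∉ T → e ∈ T →
    ∃ λ c → c ∈ T × T ⊖ c List.∈ map (_⊖ μ) C
  shrink {T} {e} T∈C Tμ∈C μ∉T e∈T
    with augment ∣ G ∣ ℕ.≤-refl μ∈G top (map (G ─_) C) within′ pairwise′ Tᶜ∈ Tᶜμ∈ μ∉Tᶜ
           (within T∈C e∈T) (λ { refl → μ∉T e∈T }) (λ e∈ → ∈─⁻ {X = G} e∈ (∈⊕⁺ e∈T))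
    where
    within′ : ∀ {J} → J List.∈ map (G ─_) C → J ⊆ G
    within′ J∈ with ∈-map⁻ (G ─_) J∈
    ... | J₀ , _ , refl = p─q⊆p G J₀
    pairwise′ : Pairwise (map (G ─_) C)
    pairwise′ I∈ J∈ with ∈-map⁻ (G ─_) I∈ | ∈-map⁻ (G ─_) J∈
    ... | _ , I∈C , refl | _ , J∈C , refl = ─-ws (within I∈C) (within J∈C) (pairwise I∈C J∈C)
    Tᶜ = G ─ (T ⊕ μ)
    Tᶜ∈ : Tᶜ List.∈ map (G ─_) C
    Tᶜ∈ = ∈-map⁺ (G ─_) Tμ∈C
    μ∉Tᶜ : μ ∉ Tᶜ
    μ∉Tᶜ μ∈ = ∈─⁻ {X = G} μ∈ (∈⊕ T μ)
    Tᶜμ : G ─ T ≡ Tᶜ ⊕ μ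
    Tᶜμ = ⊆-antisym to λ x∈ → from (∈⊕⁻ x∈)
      where
      to : G ─ T ⊆ Tᶜ ⊕ μ
      to {x} x∈ with x ≟ μ
      ... | yes refl = ∈⊕ Tᶜ μ
      ... | no x≢μ = ∈⊕⁺ (x∈p∧x∉q⇒x∈p─q (p─q⊆p G T x∈) (∉⊕ (∈─⁻ {X = G} x∈) x≢μ))
      from : ∀ {x} → x ≡ μ ⊎ x ∈ Tᶜ → x ∈ G ─ T
      from (inj₁ refl) = x∈p∧x∉q⇒x∈p─q μ∈G μ∉T
      from (inj₂ x∈) = x∈p∧x∉q⇒x∈p─q (p─q⊆p G (T ⊕ μ) x∈) (∉⊕⁻ (∈─⁻ {X = G} x∈))
    Tᶜμ∈ : Tᶜ ⊕ μ List.∈ map (G ─_) C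
    Tᶜμ∈ = subst (List._∈ map (G ─_) C) Tᶜμ (∈-map⁺ (G ─_) T∈C)
  ... | c , c∈G , c≢μ , c∉Tᶜ , ws = c , c∈T , subst (List._∈ map (_⊖ μ) C) W⊖μ (∈-map⁺ (_⊖ μ) W∈C)
    where
    Tᶜ = G ─ (T ⊕ μ)
    W = G ─ (Tᶜ ⊕ c)
    Tᶜc⊆G : Tᶜ ⊕ c ⊆ G
    Tᶜc⊆G = ⊕-⊆ (p─q⊆p G (T ⊕ μ)) c∈G
    c∈T : c ∈ T
    c∈T with c ∈? T
    ... | yes p = p
    ... | no c∉T = contradiction (x∈p∧x∉q⇒x∈p─q c∈G (∉⊕ c∉T c≢μ)) c∉Tᶜ
    W∈C : W List.∈ C
    W∈C = closed (p─q⊆p G (Tᶜ ⊕ c)) λ J∈C → subst (WS W) (─-involutive (within J∈C))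
      (─-ws Tᶜc⊆G (p─q⊆p G _) (ws (∈-map⁺ (G ─_) J∈C)))
    W⊖μ : W ⊖ μ ≡ T ⊖ c
    W⊖μ = ⊆-antisym to from
      where
      to : W ⊖ μ ⊆ T ⊖ c
      to {x} x∈ with x ∈? T
      ... | yes x∈T = ∈⊖⁺ x∈T λ { refl → ∈─⁻ {X = G} (∈⊖⁻ {X = W} x∈) (∈⊕ Tᶜ c) }
      ... | no x∉T = contradiction
        (∈⊕⁺ (x∈p∧x∉q⇒x∈p─q (p─q⊆p G (Tᶜ ⊕ c) (∈⊖⁻ {X = W} x∈)) (∉⊕ x∉T (⊖-≢ {X = W} x∈))))
        (∈─⁻ {X = G} (∈⊖⁻ {X = W} x∈))
      from : T ⊖ c ⊆ W ⊖ μ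
      from x∈ = ∈⊖⁺ (x∈p∧x∉q⇒x∈p─q (within T∈C x∈T)
          (∉⊕ (λ x∈Tᶜ → ∈─⁻ {X = G} x∈Tᶜ (∈⊕⁺ x∈T)) (⊖-≢ {X = T} x∈)))
          λ { refl → μ∉T x∈T }
        where x∈T = ∈⊖⁻ {X = T} x∈

  module _ {Z T} (Z⊆G⊖μ : Z ⊆ G ⊖ μ) (wsZ : ∀ {J} → J List.∈ map (_⊖ μ) C → WS Z J)
    (∣T∣ : ∣ T ∣ ≡ ∣ Z ∣) (μ∉T : μ ∉ T) (T∈C : T List.∈ C) (Tμ∈C : T ⊕ μ List.∈ C) where

    private
      Z⊆G : Z ⊆ G
      Z⊆G = ∈⊖⁻ {X = G} ∘ Z⊆G⊖μ
      μ∉Z : μ ∉ Z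
      μ∉Z = ∉⊖ G μ ∘ Z⊆G⊖μ
      T⊆G = within T∈C
      Z≤T : ∣ Z ∣ ℕ.≤ ∣ T ∣
      Z≤T = ℕ.≤-reflexive (sym ∣T∣)
      T≤Z : ∣ T ∣ ℕ.≤ ∣ Z ∣
      T≤Z = ℕ.≤-reflexive ∣T∣

      below-top : ∀ {x y} → y ∈ G → y ≢ μ → x < y → x ≢ μ
      below-top = top-≢ top

      wsZ⊖ : ∀ {J} → J List.∈ C → WS Z (J ⊖ μ)
      wsZ⊖ J∈C = wsZ (∈-map⁺ (_⊖ μ) J∈C)

      wsZ∉ : ∀ {J} → J List.∈ C → μ ∉ J → WS Z J
      wsZ∉ J∈C μ∉J = subst (WS Z) (⊖-absent μ∉J) (wsZ⊖ J∈C)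

      -- The decisive members contain μ and are larger than Z, hence than T: these satisfy
      -- `T ◁ J ⊖ μ`, and `◁-compose` carries this over to Z.
      left : Z ◁ T → ∀ {J} → J List.∈ C → WS Z J
      left Z◁T {J} J∈C with μ ∈? J | ∣ J ∣ ℕ.≤? ∣ Z ∣
      ... | no μ∉J | _ = wsZ∉ J∈C μ∉J
      ... | yes μ∈J | yes J≤Z = inj₁ (J≤Z , λ (_ , _ , _ , (x∈ , x∉) , (y∈ , y∉) , (z∈ , z∉) , x<y , y<z) →
          ws-noAlt (wsZ⊖ J∈C) (subst (ℕ._≤ ∣ Z ∣) (∣⊖∣ μ∈J) J≤Z)
            (alt (x∈ , x∉ ∘ ∈⊖⁻ {X = J})
              (∈⊖⁺ y∈ (below-top (Z⊆G z∈) (λ { refl → μ∉Z z∈ }) y<z) , y∉) (z∈ , z∉ ∘ ∈⊖⁻ {X = J}) x<y y<z))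
      ... | yes μ∈J | no J≰Z = inj₂ (ℕ.<⇒≤ Z<J , λ (_ , _ , _ , (x∈ , x∉) , (y∈ , y∉) , _ , x<y , _) →
          <-asym x<y (Z◁Y (y∈ , y∉ ∘ ∈⊖⁻ {X = J})
            (∈⊖⁺ x∈ (below-top (Z⊆G y∈) (λ { refl → μ∉Z y∈ }) x<y) , x∉)))
        where
        Z<J = ℕ.≰⇒> J≰Z
        T<J = subst (ℕ._< ∣ J ∣) (sym ∣T∣) Z<J
        T≤Y : ∣ T ∣ ℕ.≤ ∣ J ⊖ μ ∣
        T≤Y = ℕ.s≤s⁻¹ (subst (∣ T ∣ ℕ.<_) (∣⊖∣ μ∈J) T<J)
        option : WS Z (J ⊖ μ) →
          NoAlt (J ⊖ μ) Z ⊎ (NoAlt Z (J ⊖ μ) × (∀ {x} → Diff (J ⊖ μ) T x → ∃ (Diff T (J ⊖ μ))))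
        option (inj₁ (Y≤Z , n)) = inj₂ (n , balance (ℕ.≤-trans Y≤Z Z≤T))
        option (inj₂ (_ , n)) = inj₁ n
        Z◁Y : Z ◁ J ⊖ μ
        Z◁Y = Direct.◁-compose Z◁T
          (noAlt⇒◁-⊖ top T⊆G μ∉T μ∈J (ws-noAlt (pairwise J∈C T∈C) T<J))
          (option (wsZ⊖ J∈C))
          (balance Z≤T) (balance T≤Z) (balance T≤Y)

      -- The decisive members omit μ and are no larger than Z: separation from `T ⊕ μ` gives
      -- `J ◁ T`, and the reversed `◁-compose` gives `J ◁ Z`.
      right : T ◁ Z → ∀ {J} → J List.∈ C → WS (Z ⊕ μ) J
      right T◁Z {J} J∈C with μ ∈? J | ∣ J ∣ ℕ.≤? ∣ Z ∣
      ... | yes μ∈J | _ = ⊖-ws⁻ (∈⊕ Z μ) μ∈J (subst (λ X → WS X (J ⊖ μ)) (sym (⊕⊖ μ∉Z)) (wsZ⊖ J∈C))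
      ... | no μ∉J | no J≰Z = inj₂ (subst (ℕ._≤ ∣ J ∣) (sym (∣⊕∣ μ∉Z)) (ℕ.≰⇒> J≰Z) ,
          λ (_ , _ , _ , (x∈ , x∉) , (y∈ , y∉) , (z∈ , z∉) , x<y , y<z) →
            ws-noAlt (ws-sym (wsZ∉ J∈C μ∉J)) (ℕ.≰⇒> J≰Z)
              (alt (x∈ , ∉⊕⁻ x∉) (update⁻ (below-top (within J∈C z∈) (λ { refl → μ∉J z∈ }) y<z) y∈ , y∉)
                (z∈ , ∉⊕⁻ z∉) x<y y<z))
      ... | no μ∉J | yes J≤Z = inj₁ (subst (∣ J ∣ ℕ.≤_) (sym (∣⊕∣ μ∉Z)) (ℕ.m≤n⇒m≤1+n J≤Z) ,
          λ (_ , _ , _ , (x∈ , x∉) , (y∈ , y∉) , _ , x<y , _) →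
            <-asym x<y (J◁Z (y∈ , ∉⊕⁻ y∉)
              (update⁻ (below-top (within J∈C y∈) (λ { refl → μ∉J y∈ }) x<y) x∈ , x∉)))
        where
        J≤T : ∣ J ∣ ℕ.≤ ∣ T ∣
        J≤T = ℕ.≤-trans J≤Z Z≤T
        J◁T : J ◁ T
        J◁T = noAlt⇒◁ top (within J∈C) μ∉J (ws-noAlt (pairwise Tμ∈C J∈C)
          (subst (∣ J ∣ ℕ.<_) (sym (∣⊕∣ μ∉T)) (s≤s J≤T)))
        option : WS Z J → NoAlt Z J ⊎ (NoAlt J Z × (∀ {x} → Diff T J x → ∃ (Diff J T)))
        option (inj₁ (_ , n)) = inj₁ n
        option (inj₂ (Z≤J , n)) = inj₂ (n , balance (ℕ.≤-trans T≤Z Z≤J))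
        J◁Z : J ◁ Z
        J◁Z = Dual.◁-compose {Z = Z} {T} {J} T◁Z J◁T
          (option (wsZ∉ J∈C μ∉J))
          (balance T≤Z) (balance Z≤T) (balance J≤T)

      -- All of Z ∖ T lies between τ and τ′. By equality of sizes some ξ in Z ∖ T differs from c, so
      -- the larger set `T ⊕ c` alternates around Z as τ < ξ < τ′.
      inner : ∀ {τ ζ ζ′ τ′} → NoAlt Z T → Diff T Z τ → Diff Z T ζ → τ < ζ →
        Diff Z T ζ′ → Diff T Z τ′ → ζ′ < τ′ → ⊥
      inner {τ} {ζ} {ζ′} {τ′} n τ∈ ζ∈ τ<ζ ζ′∈ τ′∈ ζ′<τ′
        with Direct.between n τ∈ ζ∈ τ<ζ ζ′∈ τ′∈ ζ′<τ′
           | enlarge T∈C Tμ∈C μ∉T (Z⊆G (proj₁ ζ∈)) (λ { refl → μ∉Z (proj₁ ζ∈) }) (proj₂ ζ∈)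
      ... | above , below | c , c∉T , c≢μ , Tc∈C
        with balance-avoid T≤Z τ∈ τ′∈ (λ e → <-irrefl e (<-trans (above ζ∈) (below ζ∈))) c
      ... | ξ , ξ∈ , ξ≢c = ws-noAlt (ws-sym (wsZ∉ Tc∈C (∉⊕ μ∉T (c≢μ ∘ sym))))
              (subst (∣ Z ∣ ℕ.<_) (sym (∣⊕∣ c∉T)) (s≤s Z≤T))
              (alt (∈⊕⁺ (proj₁ τ∈) , proj₂ τ∈) (proj₁ ξ∈ , ∉⊕ (proj₂ ξ∈) ξ≢c)
                (∈⊕⁺ (proj₁ τ′∈) , proj₂ τ′∈) (above ξ∈) (below ξ∈))

      -- Mirror of `inner`: Z surrounds T, hence alternates around the smaller set `T ⊖ c`.
      outer : ∀ {τ ζ ζ′ τ′} → NoAlt T Z → Diff T Z τ → Diff Z T ζ → τ < ζ →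
        Diff Z T ζ′ → Diff T Z τ′ → ζ′ < τ′ → ⊥
      outer {τ} {ζ} {ζ′} {τ′} n τ∈ ζ∈ τ<ζ ζ′∈ τ′∈ ζ′<τ′
        with Direct.between n ζ′∈ τ′∈ ζ′<τ′ τ∈ ζ∈ τ<ζ
           | shrink T∈C Tμ∈C μ∉T (proj₁ τ∈)
      ... | above , below | c , c∈T , Tc∈
        with balance-avoid Z≤T ζ′∈ ζ∈ (λ e → <-irrefl e (<-trans (above τ∈) (below τ∈))) c
      ... | ξ , ξ∈ , ξ≢c = ws-noAlt (wsZ Tc∈) (ℕ.≤-trans (ℕ.≤-reflexive (sym (∣⊖∣ c∈T))) T≤Z)
              (alt (proj₁ ζ′∈ , proj₂ ζ′∈ ∘ ∈⊖⁻ {X = T}) (∈⊖⁺ (proj₁ ξ∈) ξ≢c , proj₂ ξ∈)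
                (proj₁ ζ∈ , proj₂ ζ∈ ∘ ∈⊖⁻ {X = T}) (above ξ∈) (below ξ∈))

    ◁? : ∀ (X Y : Subset m) → X ◁ Y ⊎ ∃ λ y → ∃ λ x → Diff Y X y × Diff X Y x × y < x
    ◁? X Y with any? (λ y → any? λ x → diff? Y X y ×-dec diff? X Y x ×-dec (y <? x))
    ... | yes p = inj₂ p
    ... | no ∄ = inj₁ λ {x} {y} x∈ y∈ → case x y x∈ y∈ (<-cmp x y)
      where
      case : ∀ x y → Diff X Y x → Diff Y X y → Tri (x < y) (x ≡ y) (y < x) → x < y
      case x y x∈ y∈ (tri< p _ _) = p
      case x y x∈ y∈ (tri≈ _ e _) = ⊥-elim (D-≢ x∈ y∈ e)
      case x y x∈ y∈ (tri> _ _ p) = contradiction (y , x , y∈ , x∈ , p) ∄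

    quotient-closed-at : Z List.∈ map (_⊖ μ) C
    quotient-closed-at with ◁? Z T | ◁? T Z
    ... | inj₁ Z◁T | _ = subst (List._∈ map (_⊖ μ) C) (⊖-absent μ∉Z) (∈-map⁺ (_⊖ μ) (closed Z⊆G (left Z◁T)))
    ... | _ | inj₁ T◁Z = subst (List._∈ map (_⊖ μ) C) (⊕⊖ μ∉Z)
                            (∈-map⁺ (_⊖ μ) (closed (⊕-⊆ Z⊆G μ∈G) (right T◁Z)))
    ... | inj₂ (_ , _ , τ∈ , ζ∈ , τ<ζ) | inj₂ (_ , _ , ζ′∈ , τ′∈ , ζ′<τ′) =
      ⊥-elim ([ (λ (_ , n) → inner n τ∈ ζ∈ τ<ζ ζ′∈ τ′∈ ζ′<τ′)
              , (λ (_ , n) → outer n τ∈ ζ∈ τ<ζ ζ′∈ τ′∈ ζ′<τ′) ]′ (wsZ∉ T∈C μ∉T))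

  quotient-maximal : Maximal (G ⊖ μ) (map (_⊖ μ) C)
  quotient-maximal = record
    { within = λ J∈ → quotient-within within μ J∈
    ; pairwise = quotient-pairwise within pairwise μ (⊖-top-ws top)
    ; closed = closed′ }
    where
    closed′ : ∀ {Z} → Z ⊆ G ⊖ μ → (∀ {J} → J List.∈ map (_⊖ μ) C → WS Z J) → Z List.∈ map (_⊖ μ) C
    closed′ {Z} Z⊆ ws with doubled (∣ G ∣) ℕ.≤-refl max μ∈G top (∣ Z ∣)
        (subst (∣ Z ∣ ℕ.<_) (sym (∣⊖∣ μ∈G)) (s≤s (p⊆q⇒∣p∣≤∣q∣ Z⊆)))
    ... | T , ∣T∣ , μ∉T , T∈C , Tμ∈C = quotient-closed-at Z⊆ ws ∣T∣ μ∉T T∈C Tμ∈C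

  -- Each set is smaller than the other with μ added, whence both `T ◁ T′` and `T′ ◁ T`; for equal
  -- sizes this leaves no difference.
  doubled-unique : ∀ {T T′} → ∣ T ∣ ≡ ∣ T′ ∣ → μ ∉ T → T List.∈ C → T ⊕ μ List.∈ C →
    μ ∉ T′ → T′ List.∈ C → T′ ⊕ μ List.∈ C → T ≡ T′
  doubled-unique eq μ∉T T∈C Tμ∈C μ∉T′ T′∈C T′μ∈C =
    ⊆-antisym (sub eq μ∉T T∈C Tμ∈C μ∉T′ T′∈C T′μ∈C) (sub (sym eq) μ∉T′ T′∈C T′μ∈C μ∉T T∈C Tμ∈C)
    where
    precedes : ∀ {T T′} → ∣ T ∣ ≡ ∣ T′ ∣ → μ ∉ T → T List.∈ C → μ ∉ T′ → T′ ⊕ μ List.∈ C → T ◁ T′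
    precedes eq μ∉T T∈C μ∉T′ T′μ∈C = noAlt⇒◁ top (within T∈C) μ∉T (ws-noAlt (pairwise T′μ∈C T∈C)
      (ℕ.≤-reflexive (trans (cong suc eq) (sym (∣⊕∣ μ∉T′)))))
    sub : ∀ {T T′} → ∣ T ∣ ≡ ∣ T′ ∣ → μ ∉ T → T List.∈ C → T ⊕ μ List.∈ C →
      μ ∉ T′ → T′ List.∈ C → T′ ⊕ μ List.∈ C → T ⊆ T′
    sub {T} {T′} eq μ∉T T∈C Tμ∈C μ∉T′ T′∈C T′μ∈C {x} x∈T with x ∈? T′
    ... | yes p = p
    ... | no x∉T′ with balance (ℕ.≤-reflexive eq) (x∈T , x∉T′)
    ... | y , y∈ = ⊥-elim (<-asym (precedes eq μ∉T T∈C μ∉T′ T′μ∈C (x∈T , x∉T′) y∈)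
                                 (precedes (sym eq) μ∉T′ T′∈C μ∉T Tμ∈C y∈ (x∈T , x∉T′)))

-- Counting

_≟ˢ_ : DecidableEquality (Subset m)
_≟ˢ_ = ≡-dec _≟ᵇ_

_∈ˢ?_ : ∀ (X : Subset m) C → Dec (X List.∈ C)
_∈ˢ?_ = DecMembership._∈?_ _≟ˢ_

unique-set⇒length : ∀ {xs ys : List A} → Unique xs → Unique ys →
  (∀ {x} → x List.∈ xs → x List.∈ ys) → (∀ {x} → x List.∈ ys → x List.∈ xs) → length xs ≡ length ys
unique-set⇒length p q to from = ↭-length (∼bag⇒↭ (unique∧set⇒bag p q (mk⇔ to from)))

unique-map : ∀ (f : A → B) {xs} → (∀ {x y} → x List.∈ xs → y List.∈ xs → f x ≡ f y → x ≡ y) →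
  Unique xs → Unique (map f xs)
unique-map f {[]} _ [] = []
unique-map f {x ∷ xs} inj (x∉ ∷ xs!) = All.tabulate distinct ∷
  unique-map f (λ p q → inj (there p) (there q)) xs!
  where
  distinct : ∀ {z} → z List.∈ map f xs → f x ≢ z
  distinct z∈ eq with ∈-map⁻ f z∈
  ... | y , y∈ , refl = All.lookup x∉ y∈ (inj (here refl) (there y∈) eq)

-- The binomial coefficient n choose 2.
pairs : ℕ → ℕ
pairs zero = 0
pairs (suc n) = n + pairs n

maximal-resp : ∀ {G : Subset m} {C D} → (∀ {X} → X List.∈ C → X List.∈ D) →
  (∀ {X} → X List.∈ D → X List.∈ C) → Maximal G C → Maximal G D
maximal-resp to from max = record
  { within = λ J∈ → within (from J∈)
  ; pairwise = λ I∈ J∈ → pairwise (from I∈) (from J∈)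
  ; closed = λ Z⊆G ws → to (closed Z⊆G (λ J∈ → ws (to J∈))) }
  where open Maximal max

module _ {G : Subset m} {C : List (Subset m)} {μ : Fin m}
  (max : Maximal G C) (μ∈G : μ ∈ G) (top : Top μ G) (C! : Unique C) where

  open Maximal max

  quotient : List (Subset m)
  quotient = deduplicate _≟ˢ_ (map (_⊖ μ) C)

  ∈-quotient⁺ : ∀ {J} → J List.∈ C → J ⊖ μ List.∈ quotient
  ∈-quotient⁺ J∈C = ∈-deduplicate⁺ _≟ˢ_ (∈-map⁺ (_⊖ μ) J∈C)

  ∈-quotient⁻ : ∀ {X} → X List.∈ quotient → ∃ λ J → J List.∈ C × X ≡ J ⊖ μ
  ∈-quotient⁻ X∈ = ∈-map⁻ (_⊖ μ) (∈-deduplicate⁻ _≟ˢ_ _ X∈)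

  doubles : List (Subset m)
  doubles = filter (λ T → ¬? (μ ∈? T) ×-dec ((T ⊕ μ) ∈ˢ? C)) C

  ∈-doubles⁻ : ∀ {T} → T List.∈ doubles → T List.∈ C × μ ∉ T × T ⊕ μ List.∈ C
  ∈-doubles⁻ = ∈-filter⁻ (λ T → ¬? (μ ∈? T) ×-dec ((T ⊕ μ) ∈ˢ? C))

  ∈-doubles⁺ : ∀ {T} → T List.∈ C → μ ∉ T → T ⊕ μ List.∈ C → T List.∈ doubles
  ∈-doubles⁺ T∈C μ∉T Tμ∈C = ∈-filter⁺ (λ T → ¬? (μ ∈? T) ×-dec ((T ⊕ μ) ∈ˢ? C)) T∈C (μ∉T , Tμ∈C)

  -- A section of the deletion of μ. It prefers the member without μ, so the members of C that it
  -- misses on the quotient are the `T ⊕ μ` with T doubled.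
  lift : Subset m → Subset m
  lift X with X ∈ˢ? C
  ... | yes _ = X
  ... | no _ = X ⊕ μ

  lift-∈ : ∀ {X} → X List.∈ C → lift X ≡ X
  lift-∈ {X} X∈C with X ∈ˢ? C
  ... | yes _ = refl
  ... | no X∉C = contradiction X∈C X∉C

  lift-∉ : ∀ {X} → ¬ X List.∈ C → lift X ≡ X ⊕ μ
  lift-∉ {X} X∉C with X ∈ˢ? C
  ... | yes X∈C = contradiction X∈C X∉C
  ... | no _ = refl

  quotient-∌ : ∀ {X} → X List.∈ quotient → μ ∉ X
  quotient-∌ X∈ with ∈-quotient⁻ X∈
  ... | J , _ , refl = ∉⊖ J μ

  lift-⊖ : ∀ {X} → μ ∉ X → lift X ⊖ μ ≡ X
  lift-⊖ {X} μ∉X with X ∈ˢ? C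
  ... | yes _ = ⊖-absent μ∉X
  ... | no _ = ⊕⊖ μ∉X

  length-quotient : length C ≡ length quotient + length doubles
  length-quotient = begin
    length C                                                  ≡⟨ unique-set⇒length C! split! to from ⟩
    length (map lift quotient ++ map (_⊕ μ) doubles)          ≡⟨ length-++ (map lift quotient) ⟩
    length (map lift quotient) + length (map (_⊕ μ) doubles)
      ≡⟨ cong₂ _+_ (length-map lift quotient) (length-map (_⊕ μ) doubles) ⟩
    length quotient + length doubles                        ∎
    where
    open ≡-Reasoning
    split! : Unique (map lift quotient ++ map (_⊕ μ) doubles)
    split! = Unique.++⁺
      (unique-map lift
        (λ X∈ Y∈ eq → trans (sym (lift-⊖ (quotient-∌ X∈))) (trans (cong (_⊖ μ) eq) (lift-⊖ (quotient-∌ Y∈))))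
        (deduplicate-! _≟ˢ_ (map (_⊖ μ) C)))
      (unique-map (_⊕ μ)
        (λ X∈ Y∈ eq → trans (sym (⊕⊖ (proj₁ (proj₂ (∈-doubles⁻ X∈)))))
          (trans (cong (_⊖ μ) eq) (⊕⊖ (proj₁ (proj₂ (∈-doubles⁻ Y∈))))))
        (Unique.filter⁺ _ C!))
      λ (p , q) → disjoint p q
      where
      disjoint : ∀ {Y} → Y List.∈ map lift quotient → Y List.∈ map (_⊕ μ) doubles → ⊥
      disjoint p q with ∈-map⁻ lift p | ∈-map⁻ (_⊕ μ) q
      ... | X , X∈ , refl | T , T∈ , eq with ∈-doubles⁻ T∈
      ... | T∈C , μ∉T , _ = quotient-∌ X∈ (subst (μ ∈_) (trans (sym eq) (lift-∈ X∈C)) (∈⊕ T μ))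
        where
        X∈C : X List.∈ C
        X∈C = subst (List._∈ C) (trans (sym (⊕⊖ μ∉T)) (trans (cong (_⊖ μ) (sym eq)) (lift-⊖ (quotient-∌ X∈)))) T∈C
    to : ∀ {J} → J List.∈ C → J List.∈ map lift quotient ++ map (_⊕ μ) doubles
    to {J} J∈C with μ ∈? J | (J ⊖ μ) ∈ˢ? C
    ... | no μ∉J | _ = ∈-++⁺ˡ (subst (List._∈ map lift quotient)
                        (trans (cong lift (⊖-absent μ∉J)) (lift-∈ J∈C)) (∈-map⁺ lift (∈-quotient⁺ J∈C)))
    ... | yes μ∈J | no X∉C = ∈-++⁺ˡ (subst (List._∈ map lift quotient)
                        (trans (lift-∉ X∉C) (⊖⊕ μ∈J)) (∈-map⁺ lift (∈-quotient⁺ J∈C)))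
    ... | yes μ∈J | yes X∈C = ∈-++⁺ʳ (map lift quotient) (subst (List._∈ map (_⊕ μ) doubles) (⊖⊕ μ∈J)
                        (∈-map⁺ (_⊕ μ) (∈-doubles⁺ X∈C (∉⊖ J μ) (subst (List._∈ C) (sym (⊖⊕ μ∈J)) J∈C))))
    from : ∀ {J} → J List.∈ map lift quotient ++ map (_⊕ μ) doubles → J List.∈ C
    from J∈ with ∈-++⁻ (map lift quotient) J∈
    ... | inj₂ p with ∈-map⁻ (_⊕ μ) p
    ... | T , T∈ , refl = proj₂ (proj₂ (∈-doubles⁻ T∈))
    from J∈ | inj₁ p with ∈-map⁻ lift p
    ... | X , X∈ , refl with X ∈ˢ? C
    ... | yes X∈C = X∈C
    ... | no X∉C with ∈-quotient⁻ X∈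
    ... | K , K∈C , refl with μ ∈? K
    ... | yes μ∈K = subst (List._∈ C) (sym (⊖⊕ μ∈K)) K∈C
    ... | no μ∉K = contradiction (subst (List._∈ C) (sym (⊖-absent μ∉K)) K∈C) X∉C

  -- Cardinality maps the doubled sets bijectively onto the numbers below |G|, by `doubled` and
  -- `doubled-unique`.
  length-doubles : length doubles ≡ ∣ G ∣
  length-doubles = begin
    length doubles              ≡⟨ length-map ∣_∣ doubles ⟨
    length (map ∣_∣ doubles)    ≡⟨ unique-set⇒length sizes! (Unique.upTo⁺ (∣ G ∣)) to from ⟩
    length (upTo ∣ G ∣)         ≡⟨ length-upTo (∣ G ∣) ⟩
    ∣ G ∣                       ∎
    where
    open ≡-Reasoning
    sizes! : Unique (map ∣_∣ doubles)
    sizes! = unique-map ∣_∣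
      (λ S∈ T∈ eq → let (S∈C , μ∉S , Sμ∈C) = ∈-doubles⁻ S∈ ; (T∈C , μ∉T , Tμ∈C) = ∈-doubles⁻ T∈ in
        doubled-unique max μ∈G top eq μ∉S S∈C Sμ∈C μ∉T T∈C Tμ∈C)
      (Unique.filter⁺ _ C!)
    to : ∀ {i} → i List.∈ map ∣_∣ doubles → i List.∈ upTo ∣ G ∣
    to i∈ with ∈-map⁻ ∣_∣ i∈
    ... | T , T∈ , refl with ∈-doubles⁻ T∈
    ... | T∈C , μ∉T , _ = ∈-upTo⁺ (p⊂q⇒∣p∣<∣q∣ (within T∈C , μ , μ∈G , μ∉T))
    from : ∀ {i} → i List.∈ upTo ∣ G ∣ → i List.∈ map ∣_∣ doubles
    from {i} i∈ with doubled (∣ G ∣) ℕ.≤-refl max μ∈G top i (∈-upTo⁻ i∈)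
    ... | T , refl , μ∉T , T∈C , Tμ∈C = ∈-map⁺ ∣_∣ (∈-doubles⁺ T∈C μ∉T Tμ∈C)

-- Deleting the greatest element loses as many members as the ground set has elements, so the count
-- is 1 plus the sum of the numbers from 1 to n.
length-maximal : ∀ n {G : Subset m} {C} → ∣ G ∣ ≡ n → Maximal G C → Unique C →
  length C ≡ suc (n + pairs n)
length-maximal zero {G} {C} ∣G∣ max C! =
  unique-set⇒length C! ([] ∷ []) to λ { (here refl) → closed ⊆-refl λ J∈C → ws-sym (⊆-ws (within J∈C)) }
  where
  open Maximal max
  to : ∀ {J} → J List.∈ C → J List.∈ G ∷ []
  to {J} J∈C = here (⊆-antisym (within J∈C) λ {x} x∈G →
    ⊥-elim (ℕ.0≢1+n (trans (sym ∣G∣) (∣⊖∣ x∈G))))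
length-maximal (suc n) {G} {C} ∣G∣ max C!
  with maximum (nonempty {G = G} (subst (0 ℕ.<_) (sym ∣G∣) (s≤s z≤n)))
... | μ , μ∈G , top = begin
  length C                                                   ≡⟨ length-quotient max μ∈G top C! ⟩
  length (quotient max μ∈G top C!) + length (doubles max μ∈G top C!)
    ≡⟨ cong₂ _+_ IH (trans (length-doubles max μ∈G top C!) ∣G∣) ⟩
  suc (n + pairs n) + suc n                              ≡⟨ ℕ.+-comm (suc (n + pairs n)) (suc n) ⟩
  suc n + suc (n + pairs n)                              ≡⟨ ℕ.+-suc (suc n) (n + pairs n) ⟩
  suc (suc n + pairs (suc n))                              ∎
  where
  open ≡-Reasoning
  IH : length (quotient max μ∈G top C!) ≡ suc (n + pairs n)
  IH = length-maximal n (ℕ.suc-injective (trans (sym (∣⊖∣ μ∈G)) ∣G∣))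
    (maximal-resp (∈-deduplicate⁺ _≟ˢ_) (∈-deduplicate⁻ _≟ˢ_ _) (quotient-maximal max μ∈G top))
    (deduplicate-! _≟ˢ_ (map (_⊖ μ) C))

-- Chamber sets

select : {P : Fin m → Set} → (∀ x → Dec (P x)) → Subset m
select P? = tabulate (λ x → does (P? x))

∈-select⁺ : ∀ {P : Fin m → Set} (P? : ∀ x → Dec (P x)) {x} → P x → x ∈ select P?
∈-select⁺ P? {x} px = lookup⇒[]= x _ (trans (lookup∘tabulate _ x) (dec-true (P? x) px))

∈-select⁻ : ∀ {P : Fin m → Set} (P? : ∀ x → Dec (P x)) {x} → x ∈ select P? → P x
∈-select⁻ P? {x} x∈ with P? x | trans (sym (lookup∘tabulate (λ x → does (P? x)) x)) ([]=⇒lookup x∈)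
... | yes px | _ = px
... | no _ | ()

surrounds⁻ : Surrounds I J → ∣ J ∣ ℕ.≤ ∣ I ∣ × NoAlt I J
surrounds⁻ {I = I} {J = J} (J≤I , J′ , J″ , (∪≡ , _) , J′≺ , ≺J″) = J≤I , noAlt
  where
  noAlt : NoAlt I J
  noAlt (_ , y , _ , (x∈I , x∉J) , (y∈J , y∉I) , (z∈I , z∉J) , x<y , y<z)
    with x∈p∪q⁻ J′ J″ (subst (y ∈_) (sym ∪≡) (x∈p∧x∉q⇒x∈p─q y∈J y∉I))
  ... | inj₁ y∈J′ = <-asym x<y (J′≺ y∈J′ (x∈p∧x∉q⇒x∈p─q x∈I x∉J))
  ... | inj₂ y∈J″ = <-asym y<z (≺J″ (x∈p∧x∉q⇒x∈p─q z∈I z∉J) y∈J″)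

-- The first part collects the elements of J ∖ I below all of I ∖ J. Any other element of J ∖ I has
-- a point of I ∖ J below it, so by `NoAlt` it has none above.
surrounds⁺ : ∣ J ∣ ℕ.≤ ∣ I ∣ → NoAlt I J → Surrounds I J
surrounds⁺ {J = J} {I = I} J≤I noAlt =
  J≤I , select below? , select above? , (⊆-antisym ∪⊆ ⊆∪ , Empty-unique disjoint) , below≺ , ≺above
  where
  Below : Fin _ → Set
  Below y = ∀ x → Diff I J x → y < x
  allBelow? : ∀ y → Dec (Below y)
  allBelow? y = all? λ x → diff? I J x →-dec (y <? x)
  below? : ∀ y → Dec (Diff J I y × Below y)
  below? y = diff? J I y ×-dec allBelow? y
  above? : ∀ y → Dec (Diff J I y × ¬ Below y)
  above? y = diff? J I y ×-dec ¬? (allBelow? y)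
  ∪⊆ : select below? ∪ select above? ⊆ J ─ I
  ∪⊆ y∈ with x∈p∪q⁻ (select below?) (select above?) y∈
  ... | inj₁ p = let ((y∈J , y∉I) , _) = ∈-select⁻ below? p in x∈p∧x∉q⇒x∈p─q y∈J y∉I
  ... | inj₂ p = let ((y∈J , y∉I) , _) = ∈-select⁻ above? p in x∈p∧x∉q⇒x∈p─q y∈J y∉I
  ⊆∪ : J ─ I ⊆ select below? ∪ select above?
  ⊆∪ {y} y∈ with allBelow? y
  ... | yes b = x∈p∪q⁺ (inj₁ (∈-select⁺ below? ((p─q⊆p J I y∈ , ∈─⁻ {X = J} y∈) , b)))
  ... | no ¬b = x∈p∪q⁺ (inj₂ (∈-select⁺ above? ((p─q⊆p J I y∈ , ∈─⁻ {X = J} y∈) , ¬b)))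
  disjoint : Empty (select below? ∩ select above?)
  disjoint (y , y∈) with x∈p∩q⁻ (select below?) (select above?) y∈
  ... | p , q = proj₂ (∈-select⁻ above? q) (proj₂ (∈-select⁻ below? p))
  below≺ : select below? ≺ (I ─ J)
  below≺ y∈ x∈ = proj₂ (∈-select⁻ below? y∈) _ (p─q⊆p I J x∈ , ∈─⁻ {X = I} x∈)
  ≺above : (I ─ J) ≺ select above?
  ≺above {x} {y} x∈ y∈ with <-cmp x y | ∈-select⁻ above? y∈
  ... | tri< x<y _ _ | _ = x<y
  ... | tri≈ _ refl _ | (_ , y∉I) , _ = contradiction (p─q⊆p I J x∈) y∉I
  ... | tri> _ _ y<x | y∈J∖I , ¬b with ¬∀⟶∃¬ _ (λ x → Diff I J x → y < x) (λ x → diff? I J x →-dec (y <? x)) ¬b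
  ... | z , ¬z with diff? I J z | <-cmp z y
  ... | no z∉ | _ = contradiction (λ z∈ → contradiction z∈ z∉) ¬z
  ... | yes z∈ | tri> _ _ y<z = contradiction (λ _ → y<z) ¬z
  ... | yes z∈ | tri≈ _ z≡y _ = ⊥-elim (D-≢ z∈ y∈J∖I z≡y)
  ... | yes z∈ | tri< z<y _ _ = ⊥-elim (noAlt (alt z∈ y∈J∖I (p─q⊆p I J x∈ , ∈─⁻ {X = I} x∈) z<y y<x))

weaklySeparated⁻ : WeaklySeparated I J → WS I J
weaklySeparated⁻ (inj₁ s) = inj₁ (surrounds⁻ s)
weaklySeparated⁻ (inj₂ s) = inj₂ (surrounds⁻ s)

weaklySeparated⁺ : WS I J → WeaklySeparated I J
weaklySeparated⁺ (inj₁ (J≤I , n)) = inj₁ (surrounds⁺ J≤I n)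
weaklySeparated⁺ (inj₂ (I≤J , n)) = inj₂ (surrounds⁺ I≤J n)

cons-collection : ∀ {C} → WeaklySeparatedCollection w C → ¬ X List.∈ C → ChamberSet w X →
  (∀ {J} → J List.∈ C → WS X J) → WeaklySeparatedCollection w (X ∷ C)
cons-collection {w = w} {X = X} {C = C} coll X∉C X∈H ws = record
  { unique = All.tabulate (λ J∈C X≡J → X∉C (subst (List._∈ C) (sym X≡J) J∈C)) ∷ unique
  ; chamber = chamber′
  ; separated = separated′ }
  where
  open WeaklySeparatedCollection coll
  chamber′ : ∀ {I} → I List.∈ X ∷ C → ChamberSet w I
  chamber′ (here refl) = X∈H
  chamber′ (there I∈) = chamber I∈
  separated′ : ∀ {I J} → I List.∈ X ∷ C → J List.∈ X ∷ C → WeaklySeparated I J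
  separated′ (here refl) (here refl) = weaklySeparated⁺ (⊆-ws ⊆-refl)
  separated′ (here refl) (there J∈) = weaklySeparated⁺ (ws J∈)
  separated′ (there I∈) (here refl) = weaklySeparated⁺ (ws-sym (ws I∈))
  separated′ (there I∈) (there J∈) = separated I∈ J∈

maximal-closed : ∀ {C} → MaximalWeaklySeparatedCollection w C → ChamberSet w X →
  (∀ {J} → J List.∈ C → WS X J) → X List.∈ C
maximal-closed {X = X} {C} max X∈H ws with X ∈ˢ? C
... | yes X∈C = X∈C
... | no X∉C = maximal (cons-collection collection X∉C X∈H ws) there (here refl)
  where open MaximalWeaklySeparatedCollection max

-- Inversions and ascending pairs

allPairs : ∀ m → List (Fin m × Fin m)
allPairs m = cartesianProduct (allFin m) (allFin m)

inversions : Permutation′ m → List (Fin m × Fin m)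
inversions {m} w = filter (inversion? w) (allPairs m)

inversions! : ∀ (w : Permutation′ m) → Unique (inversions w)
inversions! {m} w = Unique.filter⁺ (inversion? w) (Unique.cartesianProduct⁺ (Unique.allFin⁺ m) (Unique.allFin⁺ m))

∈-inversions⁺ : ∀ (w : Permutation′ m) {p} → Inversion w p → p List.∈ inversions w
∈-inversions⁺ w inv = ∈-filter⁺ (inversion? w) (∈-cartesianProduct⁺ (∈-allFin _) (∈-allFin _)) inv

∈-inversions⁻ : ∀ (w : Permutation′ m) {p} → p List.∈ inversions w → Inversion w p
∈-inversions⁻ {m} w p∈ = proj₂ (∈-filter⁻ (inversion? w) {xs = allPairs m} p∈)

ascendingPairs : ∀ m → List (Fin m × Fin m)
ascendingPairs zero = []
ascendingPairs (suc m) = map (λ y → zero , suc y) (allFin m) ++ map (λ (x , y) → suc x , suc y) (ascendingPairs m)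

length-ascendingPairs : ∀ m → length (ascendingPairs m) ≡ pairs m
length-ascendingPairs zero = refl
length-ascendingPairs (suc m) = trans (length-++ (map (λ y → zero , suc y) (allFin m)))
  (cong₂ _+_ (trans (length-map _ (allFin m)) (length-tabulate {n = m} (λ i → i)))
    (trans (length-map _ (ascendingPairs m)) (length-ascendingPairs m)))

ascendingPairs! : ∀ m → Unique (ascendingPairs m)
ascendingPairs! zero = []
ascendingPairs! (suc m) = Unique.++⁺ (Unique.map⁺ (λ { refl → refl }) (Unique.allFin⁺ m))
  (Unique.map⁺ (λ { refl → refl }) (ascendingPairs! m)) disjoint
  where
  disjoint : ∀ {p} → ¬ (p List.∈ map (λ y → zero , suc y) (allFin m) ×
    p List.∈ map (λ (x , y) → suc x , suc y) (ascendingPairs m))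
  disjoint (p∈ , q∈) with ∈-map⁻ _ p∈ | ∈-map⁻ _ q∈
  ... | _ , _ , refl | _ , _ , ()

∈-ascendingPairs⁺ : ∀ {m} {x y : Fin m} → x < y → (x , y) List.∈ ascendingPairs m
∈-ascendingPairs⁺ {suc m} {zero} {suc y} _ = ∈-++⁺ˡ (∈-map⁺ _ (∈-allFin y))
∈-ascendingPairs⁺ {suc m} {suc x} {suc y} (s≤s x<y) = ∈-++⁺ʳ _ (∈-map⁺ _ (∈-ascendingPairs⁺ x<y))

∈-ascendingPairs⁻ : ∀ {m} {x y : Fin m} → (x , y) List.∈ ascendingPairs m → x < y
∈-ascendingPairs⁻ {suc m} p∈ with ∈-++⁻ (map (λ y → zero , suc y) (allFin m)) p∈
... | inj₁ q with ∈-map⁻ _ q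
... | _ , _ , refl = s≤s z≤n
∈-ascendingPairs⁻ {suc m} p∈ | inj₂ q with ∈-map⁻ _ q
... | _ , r , refl = s≤s (∈-ascendingPairs⁻ r)

⟨$⟩ʳ-injective : ∀ (w : Permutation′ m) {x y} → w ⟨$⟩ʳ x ≡ w ⟨$⟩ʳ y → x ≡ y
⟨$⟩ʳ-injective w eq = trans (sym (inverseˡ w)) (trans (cong (w ⟨$⟩ˡ_) eq) (inverseˡ w))

-- Upper level sets and ascents between consecutive values

module _ (w : Permutation′ m) where

  private
    v : Fin m → Fin m
    v = w ⟨$⟩ʳ_

  upper : Fin m → Subset m
  upper k = select (λ x → k ≤? v x)

  ∈-upper⁺ : ∀ k {x} → k ≤ v x → x ∈ upper k
  ∈-upper⁺ k = ∈-select⁺ (λ x → k ≤? v x)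

  ∈-upper⁻ : ∀ k {x} → x ∈ upper k → k ≤ v x
  ∈-upper⁻ k = ∈-select⁻ (λ x → k ≤? v x)

  upper-chamber : ∀ k → ChamberSet w (upper k)
  upper-chamber k _ vx<vy x∈ = ∈-upper⁺ k (ℕ.≤-trans (∈-upper⁻ k x∈) (ℕ.<⇒≤ vx<vy))

  -- An element y of I below the level k and left of an element x at or above that level forms an
  -- ascent, which forces x into I.
  upper-ws : ∀ k {I} → ChamberSet w I → WS (upper k) I
  upper-ws k {I} I∈H = ◁⇒ws precedes
    where
    precedes : upper k ◁ I
    precedes {x} {y} (x∈ , x∉I) (y∈I , y∉) with <-cmp x y
    ... | tri< x<y _ _ = x<y
    ... | tri≈ _ refl _ = contradiction y∈I x∉I
    ... | tri> _ _ y<x = contradiction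
      (I∈H y<x (ℕ.<-≤-trans (ℕ.≰⇒> (λ k≤vy → y∉ (∈-upper⁺ k k≤vy))) (∈-upper⁻ k x∈)) y∈I) x∉I

  upper∈maximal : ∀ {C} → MaximalWeaklySeparatedCollection w C → ∀ k → upper k List.∈ C
  upper∈maximal max k = maximal-closed max (upper-chamber k) λ J∈C → upper-ws k (chamber J∈C)
    where open WeaklySeparatedCollection (MaximalWeaklySeparatedCollection.collection max)

  -- Let c be the position of the value w(a) + 1. If c lies right of a, the pair a, c is as
  -- required; otherwise c replaces a, which reduces the difference of values bounded by n.
  adjacent-ascent : ∀ n {a b} → toℕ (v b) ℕ.≤ n + toℕ (v a) → a < b → v a < v b →
    ∃ λ a → ∃ λ b → a < b × toℕ (v b) ≡ suc (toℕ (v a))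
  adjacent-ascent zero vb≤ _ va<vb = contradiction va<vb (ℕ.≤⇒≯ vb≤)
  adjacent-ascent (suc n) {a} {b} vb≤ a<b va<vb with toℕ (v b) ℕ.≟ suc (toℕ (v a))
  ... | yes eq = a , b , a<b , eq
  ... | no neq = go (<-cmp a c)
    where
    k<m : suc (toℕ (v a)) ℕ.< m
    k<m = ℕ.≤-<-trans va<vb (toℕ<n (v b))
    c = w ⟨$⟩ˡ fromℕ< k<m
    vc : toℕ (v c) ≡ suc (toℕ (v a))
    vc = trans (cong toℕ (inverseʳ w)) (toℕ-fromℕ< k<m)
    go : Tri (a < c) (a ≡ c) (c < a) → ∃ λ a → ∃ λ b → a < b × toℕ (v b) ≡ suc (toℕ (v a))
    go (tri< a<c _ _) = a , c , a<c , vc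
    go (tri≈ _ a≡c _) = contradiction (sym (trans (cong (toℕ ∘ v) a≡c) vc)) ℕ.1+n≢n
    go (tri> _ _ c<a) = adjacent-ascent n
      (subst (toℕ (v b) ℕ.≤_) (trans (sym (ℕ.+-suc n _)) (cong (n +_) (sym vc))) vb≤)
      (<-trans c<a a<b) (subst (ℕ._< toℕ (v b)) (sym vc) (ℕ.≤∧≢⇒< va<vb (neq ∘ sym)))

-- Exchanging two consecutive values

module Swap (w : Permutation′ m) {a b : Fin m} (a<b : a < b)
  (vb : toℕ (w ⟨$⟩ʳ b) ≡ suc (toℕ (w ⟨$⟩ʳ a))) where

  private
    v : Fin m → Fin m
    v = w ⟨$⟩ʳ_

    v-injective : ∀ {x y} → v x ≡ v y → x ≡ y
    v-injective = ⟨$⟩ʳ-injective w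

  w′ : Permutation′ m
  w′ = w ∘ₚ transpose (v a) (v b)

  private
    v′ : Fin m → Fin m
    v′ = w′ ⟨$⟩ʳ_

    va<vb : v a < v b
    va<vb = ℕ.≤-reflexive (sym vb)

    a≢b : a ≢ b
    a≢b a≡b = <-irrefl a≡b a<b

  v′-a : v′ a ≡ v b
  v′-a rewrite dec-true (v a ≟ v a) refl = refl

  v′-b : v′ b ≡ v a
  v′-b rewrite dec-false (v b ≟ v a) (λ e → a≢b (v-injective (sym e))) | dec-true (v b ≟ v b) refl = refl

  v′-other : ∀ {x} → x ≢ a → x ≢ b → v′ x ≡ v x
  v′-other {x} x≢a x≢b
    rewrite dec-false (v x ≟ v a) (x≢a ∘ v-injective) | dec-false (v x ≟ v b) (x≢b ∘ v-injective) = refl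

  above-vb : ∀ {x} → x ≢ b → v a < v x → v b < v x
  above-vb {x} x≢b va<vx = ℕ.≤∧≢⇒< (subst (ℕ._≤ toℕ (v x)) (sym vb) va<vx)
    λ e → x≢b (v-injective (toℕ-injective (sym e)))

  below-va : ∀ {x} → x ≢ a → v x < v b → v x < v a
  below-va {x} x≢a vx<vb = ℕ.≤∧≢⇒< (ℕ.s≤s⁻¹ (subst (toℕ (v x) ℕ.<_) vb vx<vb))
    λ e → x≢a (v-injective (toℕ-injective e))

  -- No value lies strictly between w(a) and w(b), so the exchange changes the relative order at the
  -- positions a, b only.
  v′-mono : ∀ {x y} → ¬ (x ≡ a × y ≡ b) → v x < v y → v′ x < v′ y
  v′-mono {x} {y} ≢ab vx<vy with x ≟ a | x ≟ b | y ≟ a | y ≟ b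
  ... | yes refl | _ | yes refl | _ = contradiction vx<vy (<-irrefl refl)
  ... | yes refl | _ | no _ | yes refl = contradiction (refl , refl) ≢ab
  ... | yes refl | _ | no y≢a | no y≢b = subst₂ _<_ (sym v′-a) (sym (v′-other y≢a y≢b)) (above-vb y≢b vx<vy)
  ... | no _ | yes refl | yes refl | _ = contradiction vx<vy (<-asym va<vb)
  ... | no _ | yes refl | no _ | yes refl = contradiction vx<vy (<-irrefl refl)
  ... | no _ | yes refl | no y≢a | no y≢b = subst₂ _<_ (sym v′-b) (sym (v′-other y≢a y≢b)) (<-trans va<vb vx<vy)
  ... | no x≢a | no x≢b | yes refl | _ = subst₂ _<_ (sym (v′-other x≢a x≢b)) (sym v′-a) (<-trans vx<vy va<vb)
  ... | no x≢a | no x≢b | no _ | yes refl = subst₂ _<_ (sym (v′-other x≢a x≢b)) (sym v′-b) (below-va x≢a vx<vy)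
  ... | no x≢a | no x≢b | no y≢a | no y≢b = subst₂ _<_ (sym (v′-other x≢a x≢b)) (sym (v′-other y≢a y≢b)) vx<vy

  v′-mono⁻ : ∀ {x y} → ¬ (x ≡ b × y ≡ a) → v′ x < v′ y → v x < v y
  v′-mono⁻ {x} {y} ≢ba v′x<v′y with <-cmp (v x) (v y)
  ... | tri< p _ _ = p
  ... | tri≈ _ e _ = contradiction v′x<v′y (<-irrefl (cong v′ (v-injective e)))
  ... | tri> _ _ vy<vx = contradiction v′x<v′y (<-asym (v′-mono (λ (y≡a , x≡b) → ≢ba (x≡b , y≡a)) vy<vx))

  ℓ-swap : ℓ w′ ≡ suc (ℓ w)
  ℓ-swap = unique-set⇒length (inversions! w′)
    (All.tabulate (λ p∈ e → new∉ (subst (List._∈ inversions w) (sym e) p∈)) ∷ inversions! w) to from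
    where
    new∉ : ¬ (a , b) List.∈ inversions w
    new∉ p∈ = <-asym (proj₂ (∈-inversions⁻ w p∈)) va<vb
    to : ∀ {p} → p List.∈ inversions w′ → p List.∈ (a , b) ∷ inversions w
    to {x , y} p∈ with x ≟ a | y ≟ b | ∈-inversions⁻ w′ p∈
    ... | yes refl | yes refl | _ = here refl
    ... | yes _ | no y≢b | x<y , inv = there (∈-inversions⁺ w (x<y , v′-mono⁻ (λ (y≡b , _) → y≢b y≡b) inv))
    ... | no x≢a | _ | x<y , inv = there (∈-inversions⁺ w (x<y , v′-mono⁻ (λ (_ , x≡a) → x≢a x≡a) inv))
    from : ∀ {p} → p List.∈ (a , b) ∷ inversions w → p List.∈ inversions w′
    from (here refl) = ∈-inversions⁺ w′ (a<b , subst₂ _<_ (sym v′-b) (sym v′-a) va<vb)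
    from (there p∈) with ∈-inversions⁻ w p∈
    ... | x<y , inv = ∈-inversions⁺ w′ (x<y , v′-mono (λ { (refl , refl) → <-asym a<b x<y }) inv)

  chamber⇒chamber′ : ChamberSet w X → ChamberSet w′ X
  chamber⇒chamber′ X∈H x<y v′x<v′y = X∈H x<y (v′-mono⁻ (λ { (refl , refl) → <-asym a<b x<y }) v′x<v′y)

  chamber′⇒chamber : ChamberSet w′ X → ¬ (a ∈ X × b ∉ X) → ChamberSet w X
  chamber′⇒chamber {X = X} X∈H ok {x} {y} x<y vx<vy x∈X with x ≟ a | y ≟ b
  ... | no x≢a | _ = X∈H x<y (v′-mono (x≢a ∘ proj₁) vx<vy) x∈X
  ... | yes _ | no y≢b = X∈H x<y (v′-mono (y≢b ∘ proj₂) vx<vy) x∈X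
  ... | yes refl | yes refl with b ∈? X
  ... | yes b∈X = b∈X
  ... | no b∉X = contradiction (x∈X , b∉X) ok

  private
    P P′ : Subset m
    P = upper w (v b)
    P′ = upper w′ (v b)

  ∈P′⁺ : ∀ {x} → v b ≤ v′ x → x ∈ P′
  ∈P′⁺ = ∈-upper⁺ w′ (v b)

  ∈P′⁻ : ∀ {x} → x ∈ P′ → v b ≤ v′ x
  ∈P′⁻ = ∈-upper⁻ w′ (v b)

  a∈P′ : a ∈ P′
  a∈P′ = ∈P′⁺ (ℕ.≤-reflexive (cong toℕ (sym v′-a)))

  b∉P′ : b ∉ P′
  b∉P′ b∈ = ℕ.<⇒≱ va<vb (subst (v b ≤_) v′-b (∈P′⁻ b∈))

  -- The chamber condition puts the elements of X ∖ P other than a to the right of b, and those of P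
  -- ∖ X other than b to the left of a. Any such element, together with a balancing one, would
  -- alternate in both directions, so X arises from P by replacing b with a.
  exchange : ChamberSet w′ X → a ∈ X → b ∉ X → WS X P → X ≡ P′
  exchange {X = X} X∈H a∈X b∉X ws = ⊆-antisym to from
    where
    a∈ : Diff X P a
    a∈ = a∈X , λ a∈P → ℕ.<⇒≱ va<vb (∈-upper⁻ w (v b) a∈P)
    b∈ : Diff P X b
    b∈ = ∈-upper⁺ w (v b) ℕ.≤-refl , b∉X
    right-of-b : ∀ {x} → Diff X P x → x ≢ a → b < x
    right-of-b {x} (x∈X , x∉P) x≢a with <-cmp b x
    ... | tri< b<x _ _ = b<x
    ... | tri≈ _ refl _ = contradiction x∈X b∉X
    ... | tri> _ x≢b x<b = contradiction (X∈H x<b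
            (subst₂ _<_ (sym (v′-other x≢a (x≢b ∘ sym))) (sym v′-b)
              (below-va x≢a (ℕ.≰⇒> (λ vb≤ → x∉P (∈-upper⁺ w (v b) vb≤))))) x∈X) b∉X
    left-of-a : ∀ {y} → Diff P X y → y ≢ b → y < a
    left-of-a {y} (y∈P , y∉X) y≢b with <-cmp y a
    ... | tri< y<a _ _ = y<a
    ... | tri≈ _ refl _ = contradiction a∈X y∉X
    ... | tri> _ y≢a a<y = contradiction (X∈H a<y
            (subst₂ _<_ (sym v′-a) (sym (v′-other y≢a y≢b))
              (above-vb y≢b (ℕ.<-≤-trans va<vb (∈-upper⁻ w (v b) y∈P)))) a∈X) y∉X
    only-a : ∀ {x} → Diff X P x → x ≡ a
    only-a {x} x∈ with x ≟ a
    ... | yes x≡a = x≡a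
    ... | no x≢a = ⊥-elim (refute ws)
      where
      refute : WS X P → ⊥
      refute (inj₁ (_ , n)) = n (alt a∈ b∈ x∈ a<b (right-of-b x∈ x≢a))
      refute (inj₂ (X≤P , n)) with balance-avoid X≤P x∈ a∈ x≢a b
      ... | y , y∈ , y≢b = n (alt y∈ a∈ b∈ (left-of-a y∈ y≢b) a<b)
    only-b : ∀ {y} → Diff P X y → y ≡ b
    only-b {y} y∈ with y ≟ b
    ... | yes y≡b = y≡b
    ... | no y≢b = ⊥-elim (refute ws)
      where
      refute : WS X P → ⊥
      refute (inj₂ (_ , n)) = n (alt y∈ a∈ b∈ (left-of-a y∈ y≢b) a<b)
      refute (inj₁ (P≤X , n)) with balance-avoid P≤X y∈ b∈ y≢b a
      ... | x , x∈ , x≢a = n (alt a∈ b∈ x∈ a<b (right-of-b x∈ x≢a))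
    to : X ⊆ P′
    to {x} x∈X with x ∈? P
    ... | no x∉P = subst (_∈ P′) (sym (only-a (x∈X , x∉P))) a∈P′
    ... | yes x∈P = ∈P′⁺ (subst (v b ≤_) (sym (v′-other x≢a λ { refl → b∉X x∈X })) (∈-upper⁻ w (v b) x∈P))
      where
      x≢a : x ≢ a
      x≢a refl = proj₂ a∈ x∈P
    from : P′ ⊆ X
    from {x} x∈P′ with x ∈? X | x ≟ a
    ... | yes x∈X | _ = x∈X
    ... | no _ | yes refl = a∈X
    ... | no x∉X | no x≢a = contradiction (only-b (∈-upper⁺ w (v b) (subst (v b ≤_) (v′-other x≢a x≢b) (∈P′⁻ x∈P′)) , x∉X)) x≢b
      where
      x≢b : x ≢ b
      x≢b refl = b∉P′ x∈P′

  -- C contains P, so a set in a larger collection for `w′` is separated from P. If it contains a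
  -- but not b, `exchange` identifies it with `P′`; otherwise it is already a chamber set of w.
  swap-maximal : ∀ {C} → MaximalWeaklySeparatedCollection w C →
    MaximalWeaklySeparatedCollection w′ (P′ ∷ C)
  swap-maximal {C} max = record { collection = collection′ ; maximal = maximal′ }
    where
    open MaximalWeaklySeparatedCollection max
    open WeaklySeparatedCollection collection
    P′∉C : ¬ P′ List.∈ C
    P′∉C P′∈C = b∉P′ (chamber P′∈C a<b va<vb a∈P′)
    collection′ : WeaklySeparatedCollection w′ (P′ ∷ C)
    collection′ = cons-collection
      (record { unique = unique ; chamber = λ I∈ → chamber⇒chamber′ (chamber I∈) ; separated = separated })
      P′∉C (upper-chamber w′ (v b)) λ J∈C → upper-ws w′ (v b) (chamber⇒chamber′ (chamber J∈C))
    maximal′ : ∀ {D} → WeaklySeparatedCollection w′ D → (∀ {X} → X List.∈ P′ ∷ C → X List.∈ D) →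
      ∀ {X} → X List.∈ D → X List.∈ P′ ∷ C
    maximal′ {D} coll C⊆D {X} X∈D with (a ∈? X) ×-dec ¬? (b ∈? X)
    ... | yes (a∈X , b∉X) = here (exchange (D.chamber X∈D) a∈X b∉X
            (weaklySeparated⁻ (D.separated X∈D (C⊆D (there (upper∈maximal w max (v b)))))))
      where module D = WeaklySeparatedCollection coll
    ... | no ok = there (maximal-closed max (chamber′⇒chamber (D.chamber X∈D) ok)
            λ J∈C → weaklySeparated⁻ (D.separated X∈D (C⊆D (there J∈C))))
      where module D = WeaklySeparatedCollection coll

-- Induction on the number of inversions

length-maximal-chamber : ∀ k (w : Permutation′ m) C →
  length (allPairs m) ℕ.≤ k + ℓ w →
  MaximalWeaklySeparatedCollection w C → length C ≡ m + ℓ w + 1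
length-maximal-chamber {m} k w C bound max
  with any? (λ a → any? λ b → (a <? b) ×-dec ((w ⟨$⟩ʳ a) <? (w ⟨$⟩ʳ b)))
-- Without ascents the chamber condition is vacuous, so C is maximal among all subsets, and every
-- ascending pair is an inversion.
... | no ∄ = begin
  length C                ≡⟨ length-maximal m (∣⊤∣≡n m) all-maximal unique ⟩
  suc (m + pairs m)     ≡⟨ ℕ.+-comm 1 (m + pairs m) ⟩
  m + pairs m + 1     ≡⟨ cong (λ n → m + n + 1) ℓ≡pairs ⟨
  m + ℓ w + 1         ∎
  where
  open ≡-Reasoning
  open MaximalWeaklySeparatedCollection max
  open WeaklySeparatedCollection collection
  all-maximal : Maximal Subset.⊤ C
  all-maximal = record
    { within = λ _ _ → ∈⊤
    ; pairwise = λ I∈ J∈ → weaklySeparated⁻ (separated I∈ J∈)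
    ; closed = λ _ → maximal-closed max λ a<b va<vb _ → contradiction (_ , _ , a<b , va<vb) ∄ }
  ℓ≡pairs : ℓ w ≡ pairs m
  ℓ≡pairs = trans (unique-set⇒length (inversions! w) (ascendingPairs! m)
      (λ p∈ → ∈-ascendingPairs⁺ (proj₁ (∈-inversions⁻ w p∈))) from) (length-ascendingPairs m)
    where
    from : ∀ {p} → p List.∈ ascendingPairs m → p List.∈ inversions w
    from {x , y} p∈ with <-cmp (w ⟨$⟩ʳ y) (w ⟨$⟩ʳ x) | ∈-ascendingPairs⁻ p∈
    ... | tri< inv _ _ | x<y = ∈-inversions⁺ w (x<y , inv)
    ... | tri≈ _ e _ | x<y = contradiction x<y (<-irrefl (sym (⟨$⟩ʳ-injective w e)))
    ... | tri> _ _ asc | x<y = contradiction (x , y , x<y , asc) ∄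
... | yes (a₀ , b₀ , a₀<b₀ , asc)
  with adjacent-ascent w (toℕ (w ⟨$⟩ʳ b₀)) (ℕ.m≤m+n _ _) a₀<b₀ asc
... | a , b , a<b , vb = step k bound
  where
  open Swap w a<b vb
  -- The bound k decreases as inversions are created and cannot run out, because there are never
  -- more inversions than pairs. Each exchange adds one both to the length of the collection and to
  -- `ℓ`.
  step : ∀ k → length (allPairs m) ℕ.≤ k + ℓ w → length C ≡ m + ℓ w + 1
  step zero bound = contradiction (ℕ.≤-trans (ℕ.≤-reflexive (sym ℓ-swap)) (length-filter (inversion? w′) (allPairs m))) (ℕ.≤⇒≯ bound)
  step (suc k) bound = ℕ.suc-injective (begin
    suc (length C)             ≡⟨ length-maximal-chamber k w′ _ (subst (length (allPairs m) ℕ.≤_)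
                                    (trans (sym (ℕ.+-suc k (ℓ w))) (cong (k +_) (sym ℓ-swap))) bound) (swap-maximal max) ⟩
    m + ℓ w′ + 1           ≡⟨ cong (λ n → m + n + 1) ℓ-swap ⟩
    m + suc (ℓ w) + 1      ≡⟨ cong (_+ 1) (ℕ.+-suc m (ℓ w)) ⟩
    suc (m + ℓ w + 1)      ∎)
    where open ≡-Reasoning

theorem12p5 : (m : ℕ) (w : Permutation′ m) (C : List (Subset m)) →
    MaximalWeaklySeparatedCollection w C → length C ≡ m + ℓ w + 1
theorem12p5 m w C = length-maximal-chamber (length (allPairs m)) w C (ℕ.m≤m+n _ _)
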